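{- Consider the following parameterized problem: given a finite connected undirected graph $G=(V,E)$ and a positive integer $k$ (the parameter), decide whether the edges of $G$ can be colored using $2$ colors such that at least $|E| + k$ pairs of vertices are rainbow connected. This problem has a kernel with at most $4k$ vertices, and hence is fixed parameter tractable with respect to $k$.
   Context: Graphs are finite, simple, undirected and connected. Pairs of vertices are unordered pairs of distinct vertices. An edge coloring is any assignment of colors to the edges (not necessarily proper). A path is a rainbow path if no two of its edges have the same color; a pair of vertices is rainbow connected (under a given edge coloring) if there is a rainbow path between them. In particular every adjacent pair is rainbow connected. A problem is fixed parameter tractable with respect to a parameter $k$ if there is an algorithm solving each instance $x$ in time $f(k)\cdot |x|^{O(1)}$, where $f$ is a function of $k$ independent of $|x|$. A kernel is an equivalent instance, obtained from the given instance by polynomial time reductions, whose size is bounded by a function of the parameter only; a kernel with at most $4k$ vertices means that there is a polynomial time algorithm transforming each instance $(G,k)$ into an instance $(G',k')$ of the same problem such that $(G,k)$ is a yes-instance if and only if $(G',k')$ is a yes-instance, $G'$ has at most $4k$ vertices, and $k'$ is bounded by a function of $k$. -}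

module Defs where

open import Data.Bool using (Bool; true; false; T)
open import Data.Fin as Fin using (Fin)
import Data.Fin.Properties as Fin
open import Data.List using (List; []; _∷_; length; map; filter; allFin; cartesianProduct)
open import Data.List.Relation.Unary.All using (All)
open import Data.List.Relation.Unary.Unique.Propositional using (Unique)
open import Data.Nat using (ℕ; _+_; _*_; _^_; _≤_; _≥_; _>_)
open import Data.Nat.Binary using (ℕᵇ; 2[1+_]; 1+[2_]; fromℕ) renaming (zero to 0ᵇ)
open import Data.Product using (Σ-syntax; _×_; _,_; uncurry)
open import Function using (_⇔_)
open import Level using (0ℓ)
open import Relation.Binary using (Rel; Symmetric; Irreflexive; Decidable)
open import Relation.Binary.Construct.Closure.ReflexiveTransitive using (Star; ε; _◅_)
open import Relation.Binary.PropositionalEquality using (_≡_)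
open import Relation.Nullary using (does)
open import Relation.Nullary.Decidable using (_×-dec_)

------------------------------------------------------------------------
-- Graphs and rainbow connections

record Graph : Set₁ where
  infix 4 _~_ _~?_
  field
    order    : ℕ
    _~_      : Rel (Fin order) 0ℓ
    _~?_     : Decidable _~_
    ~-sym    : Symmetric _~_
    ~-irrefl : Irreflexive _≡_ _~_

  Vertex : Set
  Vertex = Fin order

  Walk : Rel Vertex 0ℓ
  Walk = Star _~_

  vertices : ∀ {u v} → Walk u v → List Vertex
  vertices {u} ε       = u ∷ []
  vertices {u} (_ ◅ w) = u ∷ vertices w

  -- An unordered pair of distinct vertices is listed once, smaller vertex first.
  edges : List (Vertex × Vertex)
  edges = filter (uncurry λ u v → (u Fin.<? v) ×-dec (u ~? v))
                 (cartesianProduct (allFin order) (allFin order))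

  ∣E∣ : ℕ
  ∣E∣ = length edges

  Connected : Set
  Connected = order > 0 × (∀ u v → Walk u v)

  -- The condition colour-sym makes the colour depend only on the unordered pair
  -- of end vertices, and in particular not on the proof of adjacency.
  record Colouring (q : ℕ) : Set where
    field
      colour     : ∀ {u v} → u ~ v → Fin q
      colour-sym : ∀ {u v} (e : u ~ v) (e′ : v ~ u) → colour e ≡ colour e′

    colours : ∀ {u v} → Walk u v → List (Fin q)
    colours ε       = []
    colours (e ◅ w) = colour e ∷ colours w

    RainbowPath : Rel Vertex 0ℓ
    RainbowPath u v = Σ[ w ∈ Walk u v ] Unique (vertices w) × Unique (colours w)

    AtLeastRainbowConnectedPairs : ℕ → Set
    AtLeastRainbowConnectedPairs m =
      Σ[ ps ∈ List (Vertex × Vertex) ]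
        Unique ps × All (uncurry λ u v → u Fin.< v × RainbowPath u v) ps
        × length ps ≥ m

------------------------------------------------------------------------
-- Model of computation: a WHILE language over binary trees, in the style of
-- N. D. Jones, with a single implicit store.

data Tree : Set where
  leaf : Tree
  node : Tree → Tree → Tree

size : Tree → ℕ
size leaf       = 1
size (node l r) = 1 + size l + size r

leftᵗ rightᵗ : Tree → Tree
leftᵗ leaf        = leaf
leftᵗ (node l _)  = l
rightᵗ leaf       = leaf
rightᵗ (node _ r) = r

infixr 5 _⨾_

data Program : Set where
  skip nil left right : Program
  pair                : Program → Program → Program
  _⨾_                 : Program → Program → Program
  if_then_else_       : Program → Program → Program → Program
  while_loop_           : Program → Program → Program

-- p ∙ x ⇓ y ⟨ t ⟩ : started on x, the program p halts with result y in time t.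
-- Tests regard leaf as false and every node as true.  Each elementary step is
-- charged the size of the tree it acts on, so that size y ≤ t holds throughout
-- (sharing cannot hide exponentially large data), and running times agree with
-- those of Turing machines up to a polynomial.

infix 4 _∙_⇓_⟨_⟩

data _∙_⇓_⟨_⟩ : Program → Tree → Tree → ℕ → Set where
  ⇓-skip  : ∀ {x} → skip ∙ x ⇓ x ⟨ size x ⟩
  ⇓-nil   : ∀ {x} → nil ∙ x ⇓ leaf ⟨ size x ⟩
  ⇓-left  : ∀ {x} → left ∙ x ⇓ leftᵗ x ⟨ size x ⟩
  ⇓-right : ∀ {x} → right ∙ x ⇓ rightᵗ x ⟨ size x ⟩
  ⇓-pair  : ∀ {p q x y z s t} →
            p ∙ x ⇓ y ⟨ s ⟩ → q ∙ x ⇓ z ⟨ t ⟩ →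
            pair p q ∙ x ⇓ node y z ⟨ size x + s + t ⟩
  ⇓-seq   : ∀ {p q x y z s t} →
            p ∙ x ⇓ y ⟨ s ⟩ → q ∙ y ⇓ z ⟨ t ⟩ →
            p ⨾ q ∙ x ⇓ z ⟨ s + t ⟩
  ⇓-then  : ∀ {b p q x l r y s t} →
            b ∙ x ⇓ node l r ⟨ s ⟩ → p ∙ x ⇓ y ⟨ t ⟩ →
            if b then p else q ∙ x ⇓ y ⟨ size x + s + t ⟩
  ⇓-else  : ∀ {b p q x y s t} →
            b ∙ x ⇓ leaf ⟨ s ⟩ → q ∙ x ⇓ y ⟨ t ⟩ →
            if b then p else q ∙ x ⇓ y ⟨ size x + s + t ⟩
  ⇓-stop  : ∀ {b p x s} →
            b ∙ x ⇓ leaf ⟨ s ⟩ →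
            while b loop p ∙ x ⇓ x ⟨ size x + s ⟩
  ⇓-step  : ∀ {b p x l r y z s t u} →
            b ∙ x ⇓ node l r ⟨ s ⟩ → p ∙ x ⇓ y ⟨ t ⟩ →
            while b loop p ∙ y ⇓ z ⟨ u ⟩ →
            while b loop p ∙ x ⇓ z ⟨ size x + s + t + u ⟩

------------------------------------------------------------------------
-- Encodings of data as trees

encodeBool : Bool → Tree
encodeBool false = leaf
encodeBool true  = node leaf leaf

encodeList : {A : Set} → (A → Tree) → List A → Tree
encodeList f []       = leaf
encodeList f (x ∷ xs) = node (f x) (encodeList f xs)

encodeℕᵇ : ℕᵇ → Tree
encodeℕᵇ 0ᵇ       = leaf
encodeℕᵇ 2[1+ b ] = node (encodeBool false) (encodeℕᵇ b)
encodeℕᵇ 1+[2 b ] = node (encodeBool true) (encodeℕᵇ b)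

-- Numbers are written in binary, so a number k has size O(log k).
encodeℕ : ℕ → Tree
encodeℕ k = encodeℕᵇ (fromℕ k)

adjacencyMatrix : Graph → List (List Bool)
adjacencyMatrix G = map (λ u → map (λ v → does (u ~? v)) (allFin order)) (allFin order)
  where open Graph G

encodeGraph : Graph → Tree
encodeGraph G = encodeList (encodeList encodeBool) (adjacencyMatrix G)

------------------------------------------------------------------------
-- Parameterized problems

record ParameterizedProblem : Set₂ where
  field
    Instance  : Set₁
    encode    : Instance → Tree
    parameter : Instance → ℕ
    Yes       : Instance → Set

  ∣_∣ : Instance → ℕ
  ∣ x ∣ = size (encode x)

  FixedParameterTractable : Set₁
  FixedParameterTractable =
    Σ[ p ∈ Program ] Σ[ f ∈ (ℕ → ℕ) ] Σ[ d ∈ ℕ ] ∀ (x : Instance) →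
      Σ[ b ∈ Bool ] Σ[ t ∈ ℕ ] (p ∙ encode x ⇓ encodeBool b ⟨ t ⟩)
        × (Yes x ⇔ T b)
        × t ≤ f (parameter x) * ∣ x ∣ ^ d

  -- A polynomial time transformation to equivalent instances y of the same
  -- problem, with measure y ≤ bound k and with parameter bounded in terms of k.
  HasKernel : (measure : Instance → ℕ) (bound : ℕ → ℕ) → Set₁
  HasKernel measure bound =
    Σ[ p ∈ Program ] Σ[ c ∈ ℕ ] Σ[ d ∈ ℕ ] Σ[ g ∈ (ℕ → ℕ) ] ∀ (x : Instance) →
      Σ[ y ∈ Instance ] Σ[ t ∈ ℕ ] (p ∙ encode x ⇓ encode y ⟨ t ⟩)
        × t ≤ c * ∣ x ∣ ^ d
        × (Yes x ⇔ Yes y)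
        × measure y ≤ bound (parameter x)
        × parameter y ≤ g (parameter x)

------------------------------------------------------------------------
-- The problem

record RainbowInstance : Set₁ where
  field
    graph     : Graph
    connected : Graph.Connected graph
    k         : ℕ
    k>0       : k > 0

  open Graph graph public

TwoColourable : RainbowInstance → Set
TwoColourable x = Σ[ c ∈ Colouring 2 ] Colouring.AtLeastRainbowConnectedPairs c (∣E∣ + k)
  where open RainbowInstance x

MaxRainbow2Colouring : ParameterizedProblem
MaxRainbow2Colouring = record
  { Instance  = RainbowInstance
  ; encode    = λ x → node (encodeGraph (RainbowInstance.graph x)) (encodeℕ (RainbowInstance.k x))
  ; parameter = RainbowInstance.k
  ; Yes       = TwoColourable
  }

{-# OPTIONS --safe #-}

-- With two colours, a rainbow path between non-adjacent vertices has exactly two edges, so at least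
-- |E| + k pairs are rainbow connected iff at least k non-adjacent pairs u, v have a common neighbour
-- w with uw and wv of different colours.  If G has more than 4k vertices, this is possible iff G has
-- at least k non-adjacent pairs.  Let a be the number of vertices that are not universal.
--   If a ≥ 2k, take a maximal set I of vertices no two of which are at distance 2, and colour an
-- edge by whether exactly one of its ends lies in I.  Then a pair at distance 2 is rainbow connected
-- as soon as I separates it, and every non-universal vertex lies in such a pair.
--   If a < 2k, there are more than a universal vertices.  Give each non-universal u a private
-- universal vertex φ u and colour just the edges u - φ u red: every non-adjacent pair u, v is rainbow
-- connected through φ u.
-- So a large instance is replaced by a trivial one after counting the non-adjacent pairs.

module Submission where

open import Data.Bool using (Bool; true; false; not; _∨_; _∧_; _xor_; T) renaming (if_then_else_ to ifᵇ_then_else_)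
import Data.Bool.Properties as Bool
open import Data.Fin as Fin using (Fin; zero; suc)
import Data.Fin.Properties as Fin
open import Data.List using (List; []; _∷_; _++_; foldl; length; filter; map; allFin; cartesianProduct; reverse; tabulate; applyUpTo; upTo; downFrom)
import Data.List.Membership.DecPropositional as DecMembership
open import Data.List.Membership.Propositional using (_∈_; find; lose)
open import Data.List.Membership.Propositional.Properties
open import Data.List.Properties
open import Data.List.Relation.Unary.All using (All; []; _∷_)
import Data.List.Relation.Unary.All as All
import Data.List.Relation.Unary.All.Properties as All
open import Data.List.Relation.Unary.AllPairs using ([]; _∷_)
open import Data.List.Relation.Unary.Any using (Any; here; there; any?)
open import Data.List.Relation.Unary.Unique.Propositional using (Unique)
import Data.List.Relation.Unary.Unique.Propositional.Properties as Unique
open import Data.Nat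
open import Data.Nat.Binary using (2[1+_]; 1+[2_]; fromℕ; toℕ) renaming (zero to 0ᵇ)
open import Data.Nat.Binary.Properties using (toℕ-fromℕ)
open import Data.Nat.ListAction using (sum)
open import Data.Nat.Properties
open import Data.Nat.Tactic.RingSolver using (solve-∀)
open import Data.Product using (Σ-syntax; _×_; _,_; proj₁; proj₂; uncurry; swap)
open import Data.Sum using (_⊎_; inj₁; inj₂; [_,_]′)
open import Function using (_∘_; id; _⇔_; mk⇔; Equivalence)
open import Level using (0ℓ)
open import Relation.Binary using (Rel; Symmetric; Decidable; DecidableEquality; tri<; tri≈; tri>)
open import Relation.Binary.Construct.Closure.ReflexiveTransitive using (ε; _◅_; _◅◅_)
open import Relation.Binary.PropositionalEquality using (_≡_; _≢_; refl; sym; trans; cong; cong₂; subst; ≢-sym; module ≡-Reasoning)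
open import Relation.Nullary using (¬_; Dec; yes; no; does; contradiction)
open import Relation.Nullary.Decidable using (_×-dec_; _⊎-dec_; ¬?; dec-true; dec-false)
open import Relation.Nullary.Reflects using (Reflects; ofʸ; ofⁿ)
import Relation.Unary as U
open import Defs

-- The parameter is written in binary, so `k` may be exponential in the input size: neither a unary
-- copy of `k` nor a loop of length `k` is affordable. Comparisons with `k` therefore consume its
-- digits, against unary counts read off the adjacency matrix. The constant 4 is 2 + 2. One factor 2
-- arises because a linked pair may serve both of its vertices, so 2k non-universal vertices are
-- needed for k pairs; below that number, another 2k vertices are needed for the universal ones to
-- be at least as many. Running times are controlled through a small language whose only loops run
-- over lists. Polynomial steps alone do not make such a loop polynomial; an additive bound on the
-- growth of the accumulator does. Tractability comes from exhaustive search on the kernel. The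
-- candidates are all trees of bounded depth, each read as some symmetric colouring, and the search
-- time summed over the finitely many trees of a kernel's depth is already a function of `k`.

private variable
  A B : Set

-- Programs with structured loops, and polynomial running time

Run : Program → Tree → Tree → Set
Run p x y = Σ[ t ∈ ℕ ] p ∙ x ⇓ y ⟨ t ⟩

isNode : Tree → Bool
isNode leaf       = false
isNode (node _ _) = true

elems : Tree → List Tree
elems leaf       = []
elems (node a l) = a ∷ elems l

infixr 5 _⨾ᶠ_

data Fun : Set where
  idᶠ nilᶠ leftᶠ rightᶠ : Fun
  pairᶠ _⨾ᶠ_            : Fun → Fun → Fun
  ifᶠ forᶠ              : Fun → Fun → Fun → Fun

-- forᶠ L I S: starting from m = I(x), set m := S(x , a , m) for every entry a of L(x).
eval : Fun → Tree → Tree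
eval idᶠ x          = x
eval nilᶠ x         = leaf
eval leftᶠ x        = leftᵗ x
eval rightᶠ x       = rightᵗ x
eval (pairᶠ F G) x  = node (eval F x) (eval G x)
eval (F ⨾ᶠ G) x     = eval G (eval F x)
eval (ifᶠ B F G) x  = ifᵇ isNode (eval B x) then eval F x else eval G x
eval (forᶠ L I S) x = foldl (λ m a → eval S (node x (node a m))) (eval I x) (elems (eval L x))

-- The state of a loop is node l (node x m) with l the entries that are still to be visited.
loopBody : Program → Program
loopBody p = pair (left ⨾ right)
                  (pair (right ⨾ left)
                        (pair (right ⨾ left) (pair (left ⨾ left) (right ⨾ right)) ⨾ p))

compile : Fun → Program
compile idᶠ          = skip
compile nilᶠ         = nil
compile leftᶠ        = left
compile rightᶠ       = right
compile (pairᶠ F G)  = pair (compile F) (compile G)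
compile (F ⨾ᶠ G)     = compile F ⨾ compile G
compile (ifᶠ B F G)  = if compile B then compile F else compile G
compile (forᶠ L I S) = pair (compile L) (pair skip (compile I))
                     ⨾ (while left loop loopBody (compile S)) ⨾ right ⨾ right

run-loopBody : ∀ {p} l x a m {y} → Run p (node x (node a m)) y →
               Run (loopBody p) (node (node a l) (node x m)) (node l (node x y))
run-loopBody l x a m (_ , r) = _ ,
  ⇓-pair (⇓-seq ⇓-left ⇓-right)
         (⇓-pair (⇓-seq ⇓-right ⇓-left)
                 (⇓-seq (⇓-pair (⇓-seq ⇓-right ⇓-left)
                                (⇓-pair (⇓-seq ⇓-left ⇓-left) (⇓-seq ⇓-right ⇓-right)))
                        r))

run-loop : ∀ {p} {f : Tree → Tree} → (∀ x → Run p x (f x)) → ∀ l x m →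
           Run (while left loop loopBody p) (node l (node x m))
               (node leaf (node x (foldl (λ m a → f (node x (node a m))) m (elems l))))
run-loop         r leaf       x m = _ , ⇓-stop ⇓-left
run-loop {f = f} r (node a l) x m = _ ,
  ⇓-step ⇓-left (proj₂ (run-loopBody l x a m (r (node x (node a m)))))
                (proj₂ (run-loop r l x (f (node x (node a m)))))

run : ∀ F x → Run (compile F) x (eval F x)
run idᶠ x          = _ , ⇓-skip
run nilᶠ x         = _ , ⇓-nil
run leftᶠ x        = _ , ⇓-left
run rightᶠ x       = _ , ⇓-right
run (pairᶠ F G) x  = _ , ⇓-pair (proj₂ (run F x)) (proj₂ (run G x))
run (F ⨾ᶠ G) x     = _ , ⇓-seq (proj₂ (run F x)) (proj₂ (run G (eval F x)))
run (ifᶠ B F G) x with eval B x | run B x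
... | leaf     | _ , r = _ , ⇓-else r (proj₂ (run G x))
... | node _ _ | _ , r = _ , ⇓-then r (proj₂ (run F x))
run (forᶠ L I S) x = _ ,
  ⇓-seq (⇓-pair (proj₂ (run L x)) (⇓-pair ⇓-skip (proj₂ (run I x))))
        (⇓-seq (proj₂ (run-loop (run S) (eval L x) x (eval I x))) (⇓-seq ⇓-right ⇓-right))

-- The cost is read off the derivation built by `run`, so bounds on it are bounds in the given
-- semantics.
time : Fun → Tree → ℕ
time F x = proj₁ (run F x)

1≤size : ∀ x → 1 ≤ size x
1≤size leaf       = ≤-refl
1≤size (node _ _) = s≤s z≤n

size-leftᵗ : ∀ x → size (leftᵗ x) ≤ size x
size-leftᵗ leaf       = ≤-refl
size-leftᵗ (node l r) = m≤n⇒m≤1+n (m≤m+n (size l) (size r))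

size-rightᵗ : ∀ x → size (rightᵗ x) ≤ size x
size-rightᵗ leaf       = ≤-refl
size-rightᵗ (node l r) = m≤n⇒m≤1+n (m≤n+m (size r) (size l))

-- Every elementary step pays for the tree it acts on, and a pair pays at least one for its new
-- node. A time bound thus also bounds the data handed to the next program.
size≤time : ∀ {p x y t} → p ∙ x ⇓ y ⟨ t ⟩ → size y ≤ t
size≤time ⇓-skip            = ≤-refl
size≤time (⇓-nil {x})       = 1≤size x
size≤time (⇓-left {x})      = size-leftᵗ x
size≤time (⇓-right {x})     = size-rightᵗ x
size≤time (⇓-pair {x = x} d e) = +-mono-≤ (+-mono-≤ (1≤size x) (size≤time d)) (size≤time e)
size≤time (⇓-seq _ e)       = m≤n⇒m≤o+n _ (size≤time e)
size≤time (⇓-then _ e)      = m≤n⇒m≤o+n _ (size≤time e)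
size≤time (⇓-else _ e)      = m≤n⇒m≤o+n _ (size≤time e)
size≤time (⇓-stop {x = x} _) = m≤m+n (size x) _
size≤time (⇓-step _ _ e)    = m≤n⇒m≤o+n _ (size≤time e)

size-eval≤time : ∀ F x → size (eval F x) ≤ time F x
size-eval≤time F x = size≤time (proj₂ (run F x))

-- The base is at least 2, so that sums and constants can be absorbed by the exponent.
Poly : (Tree → ℕ) → Set
Poly f = Σ[ e ∈ ℕ ] ∀ x → f x ≤ suc (size x) ^ e

n<2^n : ∀ n → n < 2 ^ n
n<2^n zero    = s≤s z≤n
n<2^n (suc n) = +-mono-≤ (m^n>0 2 n) (≤-trans (n<2^n n) (≤-reflexive (sym (+-identityʳ (2 ^ n)))))

2≤suc-size : ∀ x → 2 ≤ suc (size x)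
2≤suc-size x = s≤s (1≤size x)

poly-≤ : ∀ {f g} → (∀ x → f x ≤ g x) → Poly g → Poly f
poly-≤ f≤g (e , g≤) = e , λ x → ≤-trans (f≤g x) (g≤ x)

poly-const : ∀ n → Poly (λ _ → n)
poly-const n = n , λ x → ≤-trans (<⇒≤ (n<2^n n)) (^-monoˡ-≤ n (2≤suc-size x))

poly-size : Poly size
poly-size = 1 , λ x → ≤-trans (n≤1+n _) (≤-reflexive (sym (^-identityʳ _)))

poly-* : ∀ {f g} → Poly f → Poly g → Poly (λ x → f x * g x)
poly-* (d , f≤) (e , g≤) = d + e , λ x →
  ≤-trans (*-mono-≤ (f≤ x) (g≤ x)) (≤-reflexive (sym (^-distribˡ-+-* (suc (size x)) d e)))

poly-+ : ∀ {f g} → Poly f → Poly g → Poly (λ x → f x + g x)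
poly-+ {f} {g} (d , f≤) (e , g≤) = suc (d + e) , λ x →
  let s = suc (size x) in begin
    f x + g x                 ≤⟨ +-mono-≤ (≤-trans (f≤ x) (^-monoʳ-≤ s (m≤m+n d e)))
                                          (≤-trans (g≤ x) (^-monoʳ-≤ s (m≤n+m e d))) ⟩
    s ^ (d + e) + s ^ (d + e) ≡⟨ cong (s ^ (d + e) +_) (+-identityʳ _) ⟨
    2 * s ^ (d + e)           ≤⟨ *-monoˡ-≤ (s ^ (d + e)) (2≤suc-size x) ⟩
    s ^ suc (d + e)           ∎
  where open ≤-Reasoning

poly-^ : ∀ {f} e → Poly f → Poly (λ x → f x ^ e)
poly-^ zero    _ = poly-const 1
poly-^ (suc e) p = poly-* p (poly-^ e p)

poly-∘ : ∀ {f} (h : Tree → Tree) → Poly f → Poly (λ x → size (h x)) → Poly (λ x → f (h x))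
poly-∘ h (e , f≤) p = poly-≤ (λ x → f≤ (h x)) (poly-^ e (poly-+ (poly-const 1) p))

PolyTime : Fun → Set
PolyTime F = Poly (time F)

poly-eval : ∀ F → PolyTime F → Poly (λ x → size (eval F x))
poly-eval F = poly-≤ (size-eval≤time F)

id-poly : PolyTime idᶠ
id-poly = poly-size

nil-poly : PolyTime nilᶠ
nil-poly = poly-size

left-poly : PolyTime leftᶠ
left-poly = poly-size

right-poly : PolyTime rightᶠ
right-poly = poly-size

pair-poly : ∀ {F G} → PolyTime F → PolyTime G → PolyTime (pairᶠ F G)
pair-poly p q = poly-+ (poly-+ poly-size p) q

seq-poly : ∀ {F G} → PolyTime F → PolyTime G → PolyTime (F ⨾ᶠ G)
seq-poly {F} p q = poly-+ p (poly-∘ (eval F) q (poly-eval F p))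

time-if : ∀ B F G x → time (ifᶠ B F G) x ≤ size x + time B x + (time F x + time G x)
time-if B F G x with eval B x | run B x
... | leaf     | b , _ = +-monoʳ-≤ (size x + b) (m≤n+m _ (time F x))
... | node _ _ | b , _ = +-monoʳ-≤ (size x + b) (m≤m+n _ (time G x))

if-poly : ∀ {B F G} → PolyTime B → PolyTime F → PolyTime G → PolyTime (ifᶠ B F G)
if-poly {B} {F} {G} p q r =
  poly-≤ (time-if B F G) (poly-+ (poly-+ poly-size p) (poly-+ q r))

-- The coefficient 14 counts the four `pair`s and ten projections of `loopBody`, each acting on a
-- tree no larger than the state.
time-loopBody : ∀ {p} l x a m {y} (r : Run p (node x (node a m)) y) →
                proj₁ (run-loopBody l x a m r) ≤ 14 * size (node (node a l) (node x m)) + proj₁ r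
time-loopBody l x a m (t , _) = begin
  s + (s + u) + (s + (s + v) + (s + (s + v) + (s + (s + u) + (s + v)) + t))
    ≤⟨ +-mono-≤ (+-monoʳ-≤ s (+-monoʳ-≤ s u≤s))
         (+-mono-≤ (+-monoʳ-≤ s (+-monoʳ-≤ s v≤s))
           (+-monoˡ-≤ t (+-mono-≤ (+-monoʳ-≤ s (+-monoʳ-≤ s v≤s))
             (+-mono-≤ (+-monoʳ-≤ s (+-monoʳ-≤ s u≤s)) (+-monoʳ-≤ s v≤s))))) ⟩
  s + (s + s) + (s + (s + s) + (s + (s + s) + (s + (s + s) + (s + s)) + t))
    ≡⟨ lemma s t ⟩
  14 * s + t ∎
  where
  open ≤-Reasoning
  s = size (node (node a l) (node x m))
  u = size (node a l)
  v = size (node x m)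
  u≤s : u ≤ s
  u≤s = size-leftᵗ (node (node a l) (node x m))
  v≤s : v ≤ s
  v≤s = size-rightᵗ (node (node a l) (node x m))
  lemma : ∀ s t → s + (s + s) + (s + (s + s) + (s + (s + s) + (s + (s + s) + (s + s)) + t)) ≡ 14 * s + t
  lemma = solve-∀

-- When an entry `a` leaves the list, the accumulator gains at most `K` plus the size of `a`. Hence
-- the size of the state plus `K` per pending entry never increases, and `S` bounds every state. Of
-- the 16, two come from the loop test and 14 from `loopBody`.
time-loop : ∀ {p} {f : Tree → Tree} (r : ∀ x → Run p x (f x)) {K} →
            (∀ x a m → size (f (node x (node a m))) ≤ K + size a + size m) →
            ∀ {S B} → (∀ y → size y ≤ S → proj₁ (r y) ≤ B) →
            ∀ l x m → size (node l (node x m)) + K * length (elems l) ≤ S →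
            proj₁ (run-loop r l x m) ≤ suc (length (elems l)) * (16 * S + B)
time-loop r {K} grow {S} {B} r≤ leaf x m fits = begin
  s + s         ≤⟨ +-mono-≤ s≤S s≤S ⟩
  S + S         ≤⟨ m≤m+n (S + S) (14 * S + B) ⟩
  S + S + (14 * S + B) ≡⟨ lemma S B ⟩
  1 * (16 * S + B) ∎
  where
  open ≤-Reasoning
  s = size (node leaf (node x m))
  s≤S = ≤-trans (m≤m+n s (K * 0)) fits
  lemma : ∀ S B → S + S + (14 * S + B) ≡ 1 * (16 * S + B)
  lemma = solve-∀
time-loop {f = f} r {K} grow {S} {B} r≤ (node a l) x m fits = begin
  s + s + proj₁ (run-loopBody l x a m (r y)) + proj₁ (run-loop r l x (f y))
    ≤⟨ +-mono-≤ (+-mono-≤ (+-mono-≤ s≤S s≤S)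
         (≤-trans (time-loopBody l x a m (r y)) (+-mono-≤ (*-monoʳ-≤ 14 s≤S) (r≤ y y≤S))))
         (time-loop r grow r≤ l x (f y) fits′) ⟩
  S + S + (14 * S + B) + suc (length (elems l)) * (16 * S + B)
    ≡⟨ cong (_+ suc (length (elems l)) * (16 * S + B)) (lemma S B) ⟩
  suc (suc (length (elems l))) * (16 * S + B) ∎
  where
  open ≤-Reasoning
  y = node x (node a m)
  s = size (node (node a l) (node x m))
  s≤S = ≤-trans (m≤m+n s (K * length (elems (node a l)))) fits
  lemma : ∀ S B → S + S + (14 * S + B) ≡ 16 * S + B
  lemma = solve-∀
  y≤S : size y ≤ S
  y≤S = ≤-trans (≤-trans (m≤n+m (size y) (suc (size l)))
                         (≤-reflexive (sym (lemma₃ (size x) (size a) (size m) (size l))))) s≤S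
    where
    lemma₃ : ∀ x a m l → suc (suc (a + l) + suc (x + m)) ≡ suc l + suc (x + suc (a + m))
    lemma₃ = solve-∀
  fits′ : size (node l (node x (f y))) + K * length (elems l) ≤ S
  fits′ = begin
    suc (size l + suc (size x + size (f y))) + K * n
      ≤⟨ +-monoˡ-≤ (K * n) (s≤s (+-monoʳ-≤ (size l) (s≤s (+-monoʳ-≤ (size x) (grow x a m))))) ⟩
    suc (size l + suc (size x + (K + size a + size m))) + K * n
      ≤⟨ n≤1+n _ ⟩
    suc (suc (size l + suc (size x + (K + size a + size m))) + K * n)
      ≡⟨ lemma₄ (size l) (size x) K (size a) (size m) n ⟩
    s + K * suc n ≤⟨ fits ⟩
    S ∎
    where
    n = length (elems l)
    lemma₄ : ∀ l x K a m n → suc (suc (l + suc (x + (K + a + m))) + K * n)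
                           ≡ suc (suc (a + l) + suc (x + m)) + K * suc n
    lemma₄ = solve-∀

length-elems : ∀ l → length (elems l) ≤ size l
length-elems leaf       = z≤n
length-elems (node a l) = s≤s (m≤n⇒m≤o+n (size a) (length-elems l))

-- A polynomial step could still double the accumulator at every entry; additive growth rules this
-- out and keeps all states within `bnd x`.
for-poly : ∀ {L I S} K → (∀ x a m → size (eval S (node x (node a m))) ≤ K + size a + size m) →
           PolyTime L → PolyTime I → PolyTime S → PolyTime (forᶠ L I S)
for-poly {L} {I} {S} K grow pL pI (e , S≤) =
  poly-≤ bound
    (poly-+ (poly-+ (poly-+ poly-size pL) (poly-+ (poly-+ poly-size poly-size) pI))
            (poly-* (poly-const 3)
              (poly-* (poly-+ (poly-const 1) sizeL)
                      (poly-+ (poly-* (poly-const 16) pB) (poly-^ e (poly-+ (poly-const 1) pB))))))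
  where
  open ≤-Reasoning
  sizeL = poly-eval L pL
  bnd : Tree → ℕ
  bnd x = size (node (eval L x) (node x (eval I x))) + K * size (eval L x)
  pB : Poly bnd
  pB = poly-+ (poly-+ (poly-const 1) (poly-+ sizeL (poly-+ (poly-const 1) (poly-+ poly-size (poly-eval I pI)))))
              (poly-* (poly-const K) sizeL)
  bound : ∀ x → time (forᶠ L I S) x
                ≤ size x + time L x + (size x + size x + time I x)
                  + 3 * ((1 + size (eval L x)) * (16 * bnd x + (1 + bnd x) ^ e))
  bound x = +-monoʳ-≤ (size x + time L x + (size x + size x + time I x)) (begin
    -- The two final projections act on trees no larger than the final state, whose size is at most
    -- the time of the loop.
    t + (size z + size (rightᵗ z)) ≤⟨ +-monoʳ-≤ t (+-mono-≤ z≤t (≤-trans (size-rightᵗ z) z≤t)) ⟩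
    t + (t + t)                    ≡⟨ cong (λ u → t + (t + u)) (+-identityʳ t) ⟨
    3 * t                          ≤⟨ *-monoʳ-≤ 3 t≤ ⟩
    3 * ((1 + size (eval L x)) * (16 * bnd x + (1 + bnd x) ^ e)) ∎)
    where
    rl = run-loop (run S) (eval L x) x (eval I x)
    t = proj₁ rl
    z = node leaf (node x (eval (forᶠ L I S) x))
    z≤t : size z ≤ t
    z≤t = size≤time (proj₂ rl)
    t≤ : t ≤ (1 + size (eval L x)) * (16 * bnd x + (1 + bnd x) ^ e)
    t≤ = ≤-trans
      (time-loop (run S) grow {bnd x} (λ y y≤ → ≤-trans (S≤ y) (^-monoˡ-≤ e (s≤s y≤)))
        (eval L x) x (eval I x) (+-monoʳ-≤ _ (*-monoʳ-≤ K (length-elems (eval L x)))))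
      (*-monoˡ-≤ _ (s≤s (length-elems (eval L x))))

-- Finite counting

-- A relation instead of a function lets partners come from existence proofs. Deleting the partner
-- of the first entry from `ys` leaves the partners of the other entries in place, since `inj` makes
-- them different.
length-≤ : (R : A → B → Set) → (∀ {x y z} → R x z → R y z → x ≡ y) →
           ∀ {xs ys} → Unique xs → (∀ {x} → x ∈ xs → Σ[ y ∈ B ] y ∈ ys × R x y) →
           length xs ≤ length ys
length-≤ R inj {[]} _ _ = z≤n
length-≤ R inj {x ∷ xs} (x∉ ∷ u) f with f (here refl)
... | y , y∈ , Rxy with ∈-∃++ y∈
... | as , bs , refl = begin
  suc (length xs)           ≤⟨ s≤s (length-≤ R inj u g) ⟩
  suc (length (as ++ bs))   ≡⟨ cong suc (length-++ as) ⟩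
  suc (length as + length bs) ≡⟨ +-suc (length as) (length bs) ⟨
  length as + suc (length bs) ≡⟨ length-++ as ⟨
  length (as ++ y ∷ bs)     ∎
  where
  open ≤-Reasoning
  g : ∀ {x′} → x′ ∈ xs → Σ[ y′ ∈ _ ] y′ ∈ as ++ bs × R x′ y′
  g x′∈ with f (there x′∈)
  ... | y′ , y′∈ , Rx′y′ with ∈-++⁻ as y′∈
  ... | inj₁ p          = y′ , ∈-++⁺ˡ p , Rx′y′
  ... | inj₂ (there p)  = y′ , ∈-++⁺ʳ as p , Rx′y′
  ... | inj₂ (here refl) = contradiction (inj Rxy Rx′y′) (All.lookup x∉ x′∈)

length-⊆ : {xs ys : List A} → Unique xs → (∀ {x} → x ∈ xs → x ∈ ys) → length xs ≤ length ys
length-⊆ u f = length-≤ _≡_ (λ p q → trans p (sym q)) u (λ x∈ → _ , f x∈ , refl)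

module _ {P Q : U.Pred A 0ℓ} (P? : U.Decidable P) (Q? : U.Decidable Q) where

  filter-mono : {xs ys : List A} → Unique xs → (∀ {x} → x ∈ xs → P x → x ∈ ys × Q x) →
                length (filter P? xs) ≤ length (filter Q? ys)
  filter-mono u f = length-⊆ (Unique.filter⁺ P? u) λ x∈ →
    let x∈xs , Px = ∈-filter⁻ P? x∈; x∈ys , Qx = f x∈xs Px in ∈-filter⁺ Q? x∈ys Qx

-- Supplies the private universal vertices. The lists are matched entry against entry; outside `xs`
-- the values of `φ` carry no information.
matching : DecidableEquality A → {xs ys : List A} → Unique xs → Unique ys → length xs ≤ length ys →
           Σ[ φ ∈ (A → A) ] (∀ {x} → x ∈ xs → φ x ∈ ys)
             × (∀ {x y} → x ∈ xs → y ∈ xs → φ x ≡ φ y → x ≡ y)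
matching _≟_ {[]} _ _ _ = id , (λ ()) , λ ()
matching {A = A} _≟_ {x ∷ xs} {y ∷ ys} (x∉ ∷ ux) (y∉ ∷ uy) (s≤s le)
  with matching _≟_ ux uy le
... | φ , φ∈ , φ-inj = ψ , ψ∈ , ψ-inj
  where
  ψ : A → A
  ψ z = ifᵇ does (z ≟ x) then y else φ z
  ψ-x : ψ x ≡ y
  ψ-x rewrite dec-true (x ≟ x) refl = refl
  ψ-xs : ∀ {z} → z ∈ xs → ψ z ≡ φ z
  ψ-xs {z} z∈ rewrite dec-false (z ≟ x) (≢-sym (All.lookup x∉ z∈)) = refl
  ψ∈ : ∀ {z} → z ∈ x ∷ xs → ψ z ∈ y ∷ ys
  ψ∈ (here refl) = here ψ-x
  ψ∈ (there z∈)  = there (subst (_∈ ys) (sym (ψ-xs z∈)) (φ∈ z∈))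
  ψ-x≢ : ∀ {z} → z ∈ xs → ψ x ≢ ψ z
  ψ-x≢ z∈ eq = All.lookup y∉ (φ∈ z∈) (trans (sym ψ-x) (trans eq (ψ-xs z∈)))
  ψ-inj : ∀ {z w} → z ∈ x ∷ xs → w ∈ x ∷ xs → ψ z ≡ ψ w → z ≡ w
  ψ-inj (here refl) (here refl) _  = refl
  ψ-inj (here refl) (there w∈)  eq = contradiction eq (ψ-x≢ w∈)
  ψ-inj (there z∈)  (here refl) eq = contradiction (sym eq) (ψ-x≢ z∈)
  ψ-inj (there z∈)  (there w∈)  eq = φ-inj z∈ w∈ (trans (sym (ψ-xs z∈)) (trans eq (ψ-xs w∈)))

-- Ordered and unordered pairs

pairs : ∀ n → List (Fin n × Fin n)
pairs n = cartesianProduct (allFin n) (allFin n)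

∈-pairs : ∀ {n} (p : Fin n × Fin n) → p ∈ pairs n
∈-pairs (u , v) = ∈-cartesianProduct⁺ (∈-allFin u) (∈-allFin v)

pairs-unique : ∀ n → Unique (pairs n)
pairs-unique n = Unique.cartesianProduct⁺ (Unique.allFin⁺ n) (Unique.allFin⁺ n)

module _ {n} {R : Rel (Fin n) 0ℓ} (R? : Decidable R) (R-sym : Symmetric R) where

  private
    lt? = λ ((u , v) : Fin n × Fin n) → (u Fin.<? v) ×-dec R? u v
    gt? = λ ((u , v) : Fin n × Fin n) → (v Fin.<? u) ×-dec R? u v
    same? = λ ((u , v) : Fin n × Fin n) → (u Fin.≟ v) ×-dec R? u v

    split : ∀ ps → length (filter (uncurry R?) ps)
                 ≡ length (filter lt? ps) + length (filter gt? ps) + length (filter same? ps)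
    split [] = refl
    split ((u , v) ∷ ps) with R? u v | split ps | Fin.<-cmp u v
    ... | yes _ | ih | tri< a b c
      rewrite dec-true (u Fin.<? v) a | dec-false (v Fin.<? u) c | dec-false (u Fin.≟ v) b = cong suc ih
    ... | yes _ | ih | tri≈ a b c
      rewrite dec-false (u Fin.<? v) a | dec-false (v Fin.<? u) c | dec-true (u Fin.≟ v) b =
      trans (cong suc ih) (sym (+-suc _ _))
    ... | yes _ | ih | tri> a b c
      rewrite dec-false (u Fin.<? v) a | dec-true (v Fin.<? u) c | dec-false (u Fin.≟ v) b =
      trans (cong suc ih) (cong (_+ length (filter same? ps)) (sym (+-suc _ _)))
    ... | no _ | ih | _
      rewrite Bool.∧-zeroʳ (does (u Fin.<? v)) | Bool.∧-zeroʳ (does (v Fin.<? u))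
            | Bool.∧-zeroʳ (does (u Fin.≟ v)) = ih

    swap-inj : ∀ {p q r : Fin n × Fin n} → r ≡ swap p → r ≡ swap q → p ≡ q
    swap-inj refl refl = refl

  -- Swapping matches the pairs with `u` below `v` to those with `v` below `u`; the diagonal
  -- remains. Zeros of the adjacency matrix and assignments of a partner to each vertex both come as
  -- ordered pairs, hence the conversion.
  count-symmetric : length (filter (uncurry R?) (pairs n))
                  ≡ 2 * length (filter lt? (pairs n)) + length (filter (λ u → R? u u) (allFin n))
  count-symmetric = trans (split (pairs n))
    (cong₂ _+_ (trans (cong (length (filter lt? (pairs n)) +_) gt≡lt)
                      (cong (length (filter lt? (pairs n)) +_) (sym (+-identityʳ _))))
               eq≡diag)
    where
    gt≡lt : length (filter gt? (pairs n)) ≡ length (filter lt? (pairs n))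
    gt≡lt = ≤-antisym
      (length-≤ (λ p q → q ≡ swap p) swap-inj (Unique.filter⁺ gt? (pairs-unique n)) λ x∈ →
        let _ , (lt , r) = ∈-filter⁻ gt? {xs = pairs n} x∈
        in _ , ∈-filter⁺ lt? (∈-pairs _) (lt , R-sym r) , refl)
      (length-≤ (λ p q → q ≡ swap p) swap-inj (Unique.filter⁺ lt? (pairs-unique n)) λ x∈ →
        let _ , (lt , r) = ∈-filter⁻ lt? {xs = pairs n} x∈
        in _ , ∈-filter⁺ gt? (∈-pairs _) (lt , R-sym r) , refl)
    eq≡diag : length (filter same? (pairs n)) ≡ length (filter (λ u → R? u u) (allFin n))
    eq≡diag = ≤-antisym
      (length-≤ (λ p u → p ≡ (u , u)) (λ { refl refl → refl })
        (Unique.filter⁺ same? (pairs-unique n)) λ x∈ → diag (∈-filter⁻ same? {xs = pairs n} x∈))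
      (length-≤ (λ u p → p ≡ (u , u)) (λ { refl refl → refl })
        (Unique.filter⁺ (λ u → R? u u) (Unique.allFin⁺ n)) λ x∈ →
        let _ , r = ∈-filter⁻ (λ u → R? u u) {xs = allFin n} x∈
        in _ , ∈-filter⁺ same? (∈-pairs _) (refl , r) , refl)
      where
      diag : ∀ {p} → p ∈ pairs n × (proj₁ p ≡ proj₂ p × R (proj₁ p) (proj₂ p)) →
             Σ[ u ∈ Fin n ] u ∈ filter (λ u → R? u u) (allFin n) × p ≡ (u , u)
      diag {u , _} (_ , refl , r) = u , ∈-filter⁺ (λ u → R? u u) (∈-allFin u) r , refl

xor-cancel : ∀ a b c → a xor b ≡ b xor c → a ≡ c
xor-cancel false false c     eq = eq
xor-cancel false true  false eq = refl
xor-cancel true  false true  eq = refl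
xor-cancel true  true  true  eq = refl

toBit : Bool → Fin 2
toBit false = zero
toBit true  = suc zero

fromBit : Fin 2 → Bool
fromBit zero    = false
fromBit (suc _) = true

toBit-injective : ∀ {a b} → toBit a ≡ toBit b → a ≡ b
toBit-injective {false} {false} _ = refl
toBit-injective {true}  {true}  _ = refl

fromBit-injective : ∀ {i j} → fromBit i ≡ fromBit j → i ≡ j
fromBit-injective {zero}     {zero}     _ = refl
fromBit-injective {suc zero} {suc zero} _ = refl

-- Excludes rainbow paths with three or more edges, whose first three colours would be distinct.
no-3-bits : ∀ {i j k : Fin 2} → i ≢ j → i ≢ k → j ≢ k → ∀ {X : Set} → X
no-3-bits {zero}     {zero}                p _ _ = contradiction refl p
no-3-bits {zero}     {suc zero} {zero}     _ q _ = contradiction refl q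
no-3-bits {zero}     {suc zero} {suc zero} _ _ r = contradiction refl r
no-3-bits {suc zero} {suc zero}            p _ _ = contradiction refl p
no-3-bits {suc zero} {zero}     {suc zero} _ q _ = contradiction refl q
no-3-bits {suc zero} {zero}     {zero}     _ _ r = contradiction refl r

-- Rainbow connections with two colours

module _ (G : Graph) where
  open Graph G

  NonEdge : Rel Vertex 0ℓ
  NonEdge u v = ¬ u ~ v

  nonEdge? : Decidable NonEdge
  nonEdge? u v = ¬? (u ~? v)

  nonEdges : List (Vertex × Vertex)
  nonEdges = filter (uncurry λ u v → (u Fin.<? v) ×-dec nonEdge? u v) (pairs order)

  nonEdge-sym : Symmetric NonEdge
  nonEdge-sym u≁v v~u = u≁v (~-sym v~u)

  -- The summand `order` is the diagonal, which consists of zeros because adjacency is irreflexive.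
  count-nonEdges : length (filter (uncurry nonEdge?) (pairs order)) ≡ 2 * length nonEdges + order
  count-nonEdges = trans (count-symmetric nonEdge? nonEdge-sym)
    (cong (2 * length nonEdges +_)
      (trans (cong length (filter-all (λ u → nonEdge? u u) {xs = allFin order} (All.tabulate (λ {u} _ → ~-irrefl {u} refl))))
             (length-tabulate {n = order} id)))

  module _ (c : Vertex → Vertex → Bool) where

    -- Colours are a Boolean function on all pairs of vertices, so that no proof of adjacency
    -- enters. For symmetric `c` no vertex is linked to itself, as both edges would be the same.
    Linked : Rel Vertex 0ℓ
    Linked u v = ¬ u ~ v × Σ[ w ∈ Vertex ] u ~ w × w ~ v × c u w ≢ c w v

    linked? : Decidable Linked
    linked? u v = nonEdge? u v ×-dec
                  Fin.any? (λ w → (u ~? w) ×-dec (w ~? v) ×-dec ¬? (c u w Bool.≟ c w v))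

    satisfied? : U.Decidable (uncurry λ u v → u Fin.< v × Linked u v)
    satisfied? (u , v) = (u Fin.<? v) ×-dec linked? u v

    satisfied : List (Vertex × Vertex)
    satisfied = filter satisfied? (pairs order)

  record Solution (k : ℕ) : Set where
    field
      c     : Vertex → Vertex → Bool
      c-sym : ∀ u v → c u v ≡ c v u
      many  : k ≤ length (satisfied c)

  linked-sym : ∀ {c} → (∀ u v → c u v ≡ c v u) → Symmetric (Linked c)
  linked-sym c-sym {u} {v} (u≁v , w , u~w , w~v , ne) = nonEdge-sym u≁v , w , ~-sym w~v , ~-sym u~w ,
    λ eq → ne (trans (c-sym u w) (trans (sym eq) (c-sym v w)))

  count-satisfied : ∀ {c} → (∀ u v → c u v ≡ c v u) →
                    length (filter (uncurry (linked? c)) (pairs order)) ≡ 2 * length (satisfied c)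
  count-satisfied {c} c-sym = trans (count-symmetric (linked? c) (linked-sym c-sym))
    (trans (cong (λ l → 2 * length (satisfied c) + length l)
             (filter-none (λ u → linked? c u u) {xs = allFin order}
               (All.tabulate (λ {u} _ (_ , w , _ , _ , ne) → ne (c-sym u w)))))
           (+-identityʳ _))

  satisfied-≤ : ∀ c → length (satisfied c) ≤ length nonEdges
  satisfied-≤ c = filter-mono (satisfied? c) (uncurry λ u v → (u Fin.<? v) ×-dec nonEdge? u v)
    (pairs-unique order) λ p∈ (lt , u≁v , _) → p∈ , lt , u≁v

  edges-unique : Unique edges
  edges-unique = Unique.filter⁺ _ (pairs-unique order)

  edge? : U.Decidable (uncurry λ u v → u Fin.< v × u ~ v)
  edge? (u , v) = (u Fin.<? v) ×-dec (u ~? v)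

  ≢-adjacent : ∀ {u v} → u ~ v → u ≢ v
  ≢-adjacent u~v u≡v = ~-irrefl u≡v u~v

  fromSolution : ∀ {k} → Solution k →
                 Σ[ c ∈ Colouring 2 ] Colouring.AtLeastRainbowConnectedPairs c (∣E∣ + k)
  fromSolution {k} sol = col , edges ++ satisfied c , unique , All.++⁺ all-edges all-satisfied ,
    ≤-trans (+-monoʳ-≤ ∣E∣ many) (≤-reflexive (sym (length-++ edges)))
    where
    open Solution sol
    col : Colouring 2
    col = record { colour     = λ {u} {v} _ → toBit (c u v)
                 ; colour-sym = λ {u} {v} _ _ → cong toBit (c-sym u v) }
    open Colouring col using (RainbowPath)
    unique : Unique (edges ++ satisfied c)
    unique = Unique.++⁺ edges-unique (Unique.filter⁺ (satisfied? c) (pairs-unique order))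
      λ (p , q) → proj₁ (proj₂ (proj₂ (∈-filter⁻ (satisfied? c) {xs = pairs order} q)))
                        (proj₂ (proj₂ (∈-filter⁻ edge? {xs = pairs order} p)))
    all-edges : All (uncurry λ u v → u Fin.< v × RainbowPath u v) edges
    all-edges = All.map
      (λ (lt , e) → lt , e ◅ ε , (≢-adjacent e ∷ []) ∷ [] ∷ [] , [] ∷ [])
      (All.all-filter edge? (pairs order))
    all-satisfied : All (uncurry λ u v → u Fin.< v × RainbowPath u v) (satisfied c)
    all-satisfied = All.map
      (λ (lt , _ , w , e , e′ , ne) → lt , e ◅ e′ ◅ ε ,
        (≢-adjacent e ∷ Fin.<⇒≢ lt ∷ []) ∷ (≢-adjacent e′ ∷ []) ∷ [] ∷ [] ,
        ((λ eq → ne (toBit-injective eq)) ∷ []) ∷ [] ∷ [])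
      (All.all-filter (satisfied? c) (pairs order))

  module _ (col : Colouring 2) where
    open Colouring col

    -- Both colours equal that of the reversed edge.
    colour-irr : ∀ {u v} (e e′ : u ~ v) → colour e ≡ colour e′
    colour-irr e e′ = trans (colour-sym e (~-sym e)) (sym (colour-sym e′ (~-sym e)))

    bit : Vertex → Vertex → Bool
    bit u v with u ~? v
    ... | yes e = fromBit (colour e)
    ... | no _  = false

    bit-colour : ∀ {u v} (e : u ~ v) → bit u v ≡ fromBit (colour e)
    bit-colour {u} {v} e with u ~? v
    ... | yes e′ = cong fromBit (colour-irr e′ e)
    ... | no u≁v = contradiction e u≁v

    bit-sym : ∀ u v → bit u v ≡ bit v u
    bit-sym u v with u ~? v | v ~? u
    ... | yes e | yes e′ = cong fromBit (colour-sym e e′)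
    ... | yes e | no v≁u = contradiction (~-sym e) v≁u
    ... | no u≁v | yes e = contradiction (~-sym e) u≁v
    ... | no _  | no _   = refl

    -- A rainbow connected pair is adjacent or linked through a middle vertex, so the given list
    -- fits into `edges` followed by the linked pairs, and cancelling `∣E∣` leaves `k`.
    toSolution : ∀ {k} → AtLeastRainbowConnectedPairs (∣E∣ + k) → Solution k
    toSolution {k} (ps , u , all , m≤) = record
      { c = bit ; c-sym = bit-sym
      ; many = +-cancelˡ-≤ ∣E∣ k _
          (≤-trans m≤ (≤-trans (length-⊆ u (λ p∈ → classify (All.lookup all p∈)))
                              (≤-reflexive (length-++ edges)))) }
      where
      classify : ∀ {u v} → u Fin.< v × RainbowPath u v → (u , v) ∈ edges ++ satisfied bit
      classify {u} {v} (lt , path) with u ~? v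
      ... | yes e = ∈-++⁺ˡ (∈-filter⁺ edge? (∈-pairs (u , v)) (lt , e))
      ... | no u≁v with path
      ...   | ε , _ = contradiction refl (Fin.<⇒≢ lt)
      ...   | e ◅ ε , _ = contradiction e u≁v
      ...   | _◅_ {j = w} e (e′ ◅ ε) , _ , ((ne ∷ []) ∷ _) =
        ∈-++⁺ʳ edges (∈-filter⁺ (satisfied? bit) (∈-pairs (u , v))
          (lt , u≁v , w , e , e′ , λ eq → ne (fromBit-injective
            (trans (sym (bit-colour e)) (trans eq (bit-colour e′))))))
      ...   | _ ◅ (_ ◅ (_ ◅ _)) , _ , ((p ∷ q ∷ _) ∷ (r ∷ _) ∷ _) = no-3-bits p q r

  -- Universal vertices and pairs at distance 2

  Missing : Vertex → Set
  Missing v = Σ[ u ∈ Vertex ] u ≢ v × ¬ v ~ u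

  missing? : U.Decidable Missing
  missing? v = Fin.any? (λ u → ¬? (u Fin.≟ v) ×-dec nonEdge? v u)

  universal : ∀ {v} → ¬ Missing v → ∀ {u} → u ≢ v → v ~ u
  universal {v} ¬m {u} u≢v with v ~? u
  ... | yes e = e
  ... | no v≁u = contradiction (u , u≢v , v≁u) ¬m

  Distance2 : Rel Vertex 0ℓ
  Distance2 u v = u ≢ v × ¬ u ~ v × Σ[ w ∈ Vertex ] u ~ w × w ~ v

  distance2? : Decidable Distance2
  distance2? u v = ¬? (u Fin.≟ v) ×-dec nonEdge? u v ×-dec Fin.any? (λ w → (u ~? w) ×-dec (w ~? v))

  distance2-sym : Symmetric Distance2
  distance2-sym (ne , u≁v , w , e , e′) = ≢-sym ne , nonEdge-sym u≁v , w , ~-sym e′ , ~-sym e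

  -- The first vertex of the walk outside the closed neighbourhood of v.
  leave : ∀ {v x u} → x ≡ v ⊎ v ~ x → Walk x u → u ≢ v → ¬ v ~ u → Σ[ z ∈ Vertex ] Distance2 v z
  leave (inj₁ refl) ε ne _ = contradiction refl ne
  leave (inj₂ e)    ε _ ≁ = contradiction e ≁
  leave {v} at (_◅_ {j = y} e w) ne ≁ with y Fin.≟ v | v ~? y
  ... | yes y≡v | _       = leave (inj₁ y≡v) w ne ≁
  ... | no _    | yes v~y = leave (inj₂ v~y) w ne ≁
  leave (inj₁ refl) (e ◅ _) _ _ | no _ | no v≁y = contradiction e v≁y
  leave {x = x} (inj₂ v~x) (e ◅ _) _ _ | no y≢v | no v≁y = _ , ≢-sym y≢v , v≁y , x , v~x , e

  open DecMembership (Fin._≟_ {order}) using (_∈?_)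

  -- Greedy choice: a vertex enters unless it is at distance 2 from one already chosen. Domination
  -- is the form in which maximality is used: a vertex left out has a member of `I` at distance 2.
  maximalIndependent : ∀ vs → Σ[ I ∈ List Vertex ]
    (∀ {u v} → u ∈ I → v ∈ I → ¬ Distance2 u v) × (∀ {v} → v ∈ vs → v ∈ I ⊎ Any (Distance2 v) I)
  maximalIndependent [] = [] , (λ ()) , λ ()
  maximalIndependent (x ∷ vs) with maximalIndependent vs
  ... | I , ind , dom with any? (distance2? x) I
  ... | yes nbr = I , ind , λ { (here refl) → inj₂ nbr ; (there v∈) → dom v∈ }
  ... | no ¬nbr = x ∷ I ,
    (λ { (here refl) (here refl) (ne , _) → ne refl
       ; (here refl) (there v∈) d → ¬nbr (lose v∈ d)
       ; (there u∈) (here refl) d → ¬nbr (lose u∈ (distance2-sym d))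
       ; (there u∈) (there v∈) d → ind u∈ v∈ d }) ,
    (λ { (here refl) → inj₁ (here refl)
       ; (there v∈) → [ inj₁ ∘ there , inj₂ ∘ there ]′ (dom v∈) })

  missings : List Vertex
  missings = filter missing? (allFin order)

  universals : List Vertex
  universals = filter (¬? ∘ missing?) (allFin order)

  order≤ : order ≤ length missings + length universals
  order≤ = begin
    order                                  ≡⟨ length-tabulate id ⟨
    length (allFin order)                  ≤⟨ length-⊆ (Unique.allFin⁺ order) (λ {v} _ → classify v) ⟩
    length (missings ++ universals)        ≡⟨ length-++ missings ⟩
    length missings + length universals    ∎
    where
    open ≤-Reasoning
    classify : ∀ v → v ∈ missings ++ universals
    classify v with missing? v
    ... | yes m = ∈-++⁺ˡ (∈-filter⁺ missing? (∈-allFin v) m)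
    ... | no ¬m = ∈-++⁺ʳ missings (∈-filter⁺ (¬? ∘ missing?) (∈-allFin v) ¬m)

  -- With edges coloured by s u xor s v, a path u - w - v is rainbow precisely when s u ≢ s v.
  solve-many : (∀ u v → Walk u v) → ∀ {k} → 2 * k ≤ length missings → Solution k
  solve-many walk {k} le with maximalIndependent (allFin order)
  ... | I , ind , dom = record
    { c = c ; c-sym = c-sym
    -- Every non-universal vertex begins some linked ordered pair, and an unordered linked pair has
    -- two orderings.
    ; many = *-cancelˡ-≤ 2 (≤-trans le (≤-trans count (≤-reflexive (count-satisfied c-sym)))) }
    where
    s : Vertex → Bool
    s v = does (v ∈? I)
    c : Vertex → Vertex → Bool
    c u v = s u xor s v
    c-sym : ∀ u v → c u v ≡ c v u
    c-sym u v = Bool.xor-comm (s u) (s v)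
    linked : ∀ {u v} → Distance2 u v → s u ≢ s v → Linked c u v
    linked {u} {v} (_ , u≁v , w , e , e′) ne =
      u≁v , w , e , e′ , λ eq → ne (xor-cancel (s u) (s w) (s v) eq)
    partner : ∀ {v} → Missing v → Dec (v ∈ I) → Σ[ u ∈ Vertex ] Linked c v u
    -- For a member of `I`, connectedness gives a vertex at distance 2, which independence puts
    -- outside `I`; for a vertex outside `I`, maximality gives a member at distance 2.
    partner {v} (u , u≢v , v≁u) (yes v∈) =
      let z , d = leave (inj₁ refl) (walk v u) u≢v v≁u in
      z , linked d λ eq → contradiction
        (trans (sym (dec-true (v ∈? I) v∈)) (trans eq (dec-false (z ∈? I) (λ z∈ → ind v∈ z∈ d)))) λ ()
    partner {v} _ (no v∉) with dom (∈-allFin v)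
    ... | inj₁ v∈  = contradiction v∈ v∉
    ... | inj₂ nbr = let z , z∈ , d = find nbr in
      z , linked d λ eq → contradiction
        (trans (sym (dec-false (v ∈? I) v∉)) (trans eq (dec-true (z ∈? I) z∈))) λ ()
    count : length missings ≤ length (filter (uncurry (linked? c)) (pairs order))
    count = length-≤ (λ v p → v ≡ proj₁ p) (λ p q → trans p (sym q))
      (Unique.filter⁺ missing? (Unique.allFin⁺ order)) λ v∈ →
      let z , l = partner (proj₂ (∈-filter⁻ missing? {xs = allFin order} v∈)) (_ ∈? I) in
      _ , ∈-filter⁺ (uncurry (linked? c)) (∈-pairs _) l , refl

  solve-few : length missings ≤ length universals → ∀ {k} → k ≤ length nonEdges → Solution k
  solve-few le {k} k≤
    with matching Fin._≟_ (Unique.filter⁺ missing? (Unique.allFin⁺ order))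
                          (Unique.filter⁺ (¬? ∘ missing?) (Unique.allFin⁺ order)) le
  ... | φ , φ∈ , φ-inj = record
    { c = c ; c-sym = λ u v → Bool.∨-comm (m u v) (m v u)
    ; many = ≤-trans k≤ (filter-mono (uncurry λ u v → (u Fin.<? v) ×-dec nonEdge? u v) (satisfied? c)
               (pairs-unique order) (λ p∈ (lt , u≁v) → p∈ , lt , linked (Fin.<⇒≢ lt) u≁v)) }
    where
    m c : Vertex → Vertex → Bool
    -- The test `missing? u` confines `φ` to the vertices on which it is injective with universal
    -- values; `true` is red.
    m u v = does (missing? u ×-dec (φ u Fin.≟ v))
    c u v = m u v ∨ m v u
    linked : ∀ {u v} → u ≢ v → ¬ u ~ v → Linked c u v
    linked {u} {v} u≢v u≁v = u≁v , φ u , ~-sym (universal ¬mφ (λ eq → ¬mφ (subst Missing eq mu))) ,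
      universal ¬mφ (λ eq → ¬mφ (subst Missing eq mv)) , λ eq → contradiction (trans (sym red) (trans eq blue)) λ ()
      where
      mu : Missing u
      mu = v , ≢-sym u≢v , u≁v
      mv : Missing v
      mv = u , u≢v , nonEdge-sym u≁v
      ∈missings : ∀ {v} → Missing v → v ∈ missings
      ∈missings = ∈-filter⁺ missing? (∈-allFin _)
      ¬mφ : ¬ Missing (φ u)
      ¬mφ = proj₂ (∈-filter⁻ (¬? ∘ missing?) {xs = allFin order} (φ∈ (∈missings mu)))
      red : c u (φ u) ≡ true
      red = cong (_∨ m (φ u) u) (dec-true (missing? u ×-dec (φ u Fin.≟ φ u)) (mu , refl))
      -- `φ u` is universal and so has no private vertex, while the private vertex of `v` differs
      -- from `φ u` by injectivity.
      blue : c (φ u) v ≡ false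
      blue = cong₂ _∨_ (dec-false (missing? (φ u) ×-dec (φ (φ u) Fin.≟ v)) (λ (m , _) → ¬mφ m))
        (dec-false (missing? v ×-dec (φ v Fin.≟ φ u))
          (λ (_ , eq) → u≢v (φ-inj (∈missings mu) (∈missings mv) (sym eq))))

  solve-large : Connected → ∀ {k} → 4 * k < order → k ≤ length nonEdges → Solution k
  solve-large (_ , walk) {k} 4k<n k≤ with 2 * k ≤? length missings
  ... | yes le = solve-many walk le
  ... | no 2k≰ = solve-few (≤-trans few (+-cancelˡ-≤ (2 * k) _ _ many)) k≤
    where
    open ≤-Reasoning
    few : length missings ≤ 2 * k
    few = <⇒≤ (≰⇒> 2k≰)
    many : 2 * k + 2 * k ≤ 2 * k + length universals
    many = begin
      2 * k + 2 * k ≡⟨ lemma k ⟩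
      4 * k         ≤⟨ <⇒≤ 4k<n ⟩
      order         ≤⟨ order≤ ⟩
      length missings + length universals ≤⟨ +-monoˡ-≤ _ few ⟩
      2 * k + length universals ∎
      where
      lemma : ∀ k → 2 * k + 2 * k ≡ 4 * k
      lemma = solve-∀

-- The kernelisation

-- A list of leaves: loops can run over it, and successor, predecessor and zero test are elementary
-- operations.
num : ℕ → Tree
num zero    = leaf
num (suc n) = node leaf (num n)

elems-encodeList : (f : A → Tree) → ∀ xs → elems (encodeList f xs) ≡ map f xs
elems-encodeList f []       = refl
elems-encodeList f (x ∷ xs) = cong (f x ∷_) (elems-encodeList f xs)

foldl-encodeList : (g : B → Tree → B) (f : A → Tree) → ∀ m xs →
                   foldl g m (elems (encodeList f xs)) ≡ foldl (λ m x → g m (f x)) m xs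
foldl-encodeList g f m xs = trans (cong (foldl g m) (elems-encodeList f xs)) (foldl-map g f m xs)

foldl-cartesianProduct : {C : Set} (g : C → A × B → C) → ∀ m us vs →
  foldl (λ m u → foldl (λ m v → g m (u , v)) m vs) m us ≡ foldl g m (cartesianProduct us vs)
foldl-cartesianProduct g m []       vs = refl
foldl-cartesianProduct g m (u ∷ us) vs = begin
  foldl _ (foldl (λ m v → g m (u , v)) m vs) us
    ≡⟨ foldl-cartesianProduct g _ us vs ⟩
  foldl g (foldl (λ m v → g m (u , v)) m vs) (cartesianProduct us vs)
    ≡⟨ cong (λ z → foldl g z (cartesianProduct us vs)) (foldl-map g (u ,_) m vs) ⟨
  foldl g (foldl g m (map (u ,_) vs)) (cartesianProduct us vs)
    ≡⟨ foldl-++ g m (map (u ,_) vs) (cartesianProduct us vs) ⟨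
  foldl g m (map (u ,_) vs ++ cartesianProduct us vs) ∎
  where open ≡-Reasoning

foldl-count : {P : U.Pred A 0ℓ} (P? : U.Decidable P) {g : Tree → A → Tree} →
              (∀ m x → g (num m) x ≡ (ifᵇ does (P? x) then num (suc m) else num m)) →
              ∀ m xs → foldl g (num m) xs ≡ num (m + length (filter P? xs))
foldl-count P? g≡ m [] = cong num (sym (+-identityʳ m))
foldl-count P? {g} g≡ m (x ∷ xs) with P? x | g≡ m x
... | yes _ | eq = trans (cong (λ z → foldl g z xs) eq)
                         (trans (foldl-count P? g≡ (suc m) xs) (cong num (sym (+-suc m _))))
... | no _  | eq = trans (cong (λ z → foldl g z xs) eq) (foldl-count P? g≡ m xs)

eval-if-true : ∀ B F G x → isNode (eval B x) ≡ true → eval (ifᶠ B F G) x ≡ eval F x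
eval-if-true B F G x eq rewrite eq = refl

eval-if-false : ∀ B F G x → isNode (eval B x) ≡ false → eval (ifᶠ B F G) x ≡ eval G x
eval-if-false B F G x eq rewrite eq = refl

itemᶠ accᶠ trueᶠ : Fun
itemᶠ = rightᶠ ⨾ᶠ leftᶠ
accᶠ  = rightᶠ ⨾ᶠ rightᶠ
trueᶠ = pairᶠ nilᶠ nilᶠ

sucᶠ : Fun → Fun
sucᶠ F = pairᶠ nilᶠ F

constᶠ : Tree → Fun
constᶠ leaf       = nilᶠ
constᶠ (node l r) = pairᶠ (constᶠ l) (constᶠ r)

eval-const : ∀ t x → eval (constᶠ t) x ≡ t
eval-const leaf       x = refl
eval-const (node l r) x = cong₂ node (eval-const l x) (eval-const r x)

const-poly : ∀ t → PolyTime (constᶠ t)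
const-poly leaf       = nil-poly
const-poly (node l r) = pair-poly {constᶠ l} {constᶠ r} (const-poly l) (const-poly r)

item-poly : PolyTime itemᶠ
item-poly = seq-poly {rightᶠ} {leftᶠ} right-poly left-poly

acc-poly : PolyTime accᶠ
acc-poly = seq-poly {rightᶠ} {rightᶠ} right-poly right-poly

suc-poly : ∀ {F} → PolyTime F → PolyTime (sucᶠ F)
suc-poly {F} = pair-poly {nilᶠ} {F} nil-poly

-- The accumulator carries a parity bit in front of the result.
halfStepᶠ halfᶠ : Fun
halfStepᶠ = ifᶠ (accᶠ ⨾ᶠ leftᶠ) (sucᶠ (sucᶠ (accᶠ ⨾ᶠ rightᶠ))) (pairᶠ trueᶠ (accᶠ ⨾ᶠ rightᶠ))
halfᶠ = forᶠ idᶠ (sucᶠ nilᶠ) halfStepᶠ ⨾ᶠ rightᶠ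

eval-half : ∀ x → eval halfᶠ x ≡ num ⌊ length (elems x) /2⌋
eval-half x = even 0 (elems x)
  where
  step : Tree → Tree → Tree
  step m a = eval halfStepᶠ (node x (node a m))
  even : ∀ m as → rightᵗ (foldl step (node leaf (num m)) as) ≡ num (m + ⌊ length as /2⌋)
  odd  : ∀ m as → rightᵗ (foldl step (node (node leaf leaf) (num m)) as) ≡ num (m + ⌊ suc (length as) /2⌋)
  even m []       = cong num (sym (+-identityʳ m))
  even m (a ∷ as) = odd m as
  odd m []        = cong num (sym (+-identityʳ m))
  -- Of the two `sucᶠ` in the first branch of `halfStepᶠ`, the outer one resets the parity bit to
  -- `leaf` and the inner one increments the result.
  odd m (a ∷ as)  = trans (even (suc m) as) (cong num (sym (+-suc m _)))

length-num : ∀ n → length (elems (num n)) ≡ n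
length-num zero    = refl
length-num (suc n) = cong suc (length-num n)

half-num : ∀ n → eval halfᶠ (num n) ≡ num ⌊ n /2⌋
half-num n = trans (eval-half (num n)) (cong (λ k → num ⌊ k /2⌋) (length-num n))

size-num : ∀ n → size (num n) ≡ suc (2 * n)
size-num zero    = refl
size-num (suc n) = trans (cong (2 +_) (size-num n)) (cong (2 +_) (sym (+-suc n (n + 0))))

-- Gives the loop of `ltᶠ`, which halves at every digit, its growth condition.
size-half : ∀ x → size (eval halfᶠ x) ≤ size x
size-half x = begin
  size (eval halfᶠ x)          ≡⟨ cong size (eval-half x) ⟩
  size (num ⌊ length (elems x) /2⌋) ≡⟨ size-num ⌊ length (elems x) /2⌋ ⟩
  suc (2 * ⌊ length (elems x) /2⌋)  ≤⟨ s≤s (double (length (elems x))) ⟩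
  suc (length (elems x))       ≤⟨ len x ⟩
  size x                       ∎
  where
  open ≤-Reasoning
  double : ∀ n → 2 * ⌊ n /2⌋ ≤ n
  double zero          = z≤n
  double (suc zero)    = z≤n
  double (suc (suc n)) = ≤-trans (≤-reflexive (*-suc 2 ⌊ n /2⌋)) (s≤s (s≤s (double n)))
  len : ∀ x → suc (length (elems x)) ≤ size x
  len leaf       = ≤-refl
  len (node a l) = s≤s (m≤n⇒m≤o+n (size a) (len l))

half-poly : PolyTime halfᶠ
half-poly = seq-poly {forᶠ idᶠ (sucᶠ nilᶠ) halfStepᶠ} {rightᶠ}
  (for-poly {idᶠ} {sucᶠ nilᶠ} {halfStepᶠ} 4 grow id-poly (suc-poly {nilᶠ} nil-poly)
    (if-poly {accᶠ ⨾ᶠ leftᶠ} {sucᶠ (sucᶠ (accᶠ ⨾ᶠ rightᶠ))} {pairᶠ trueᶠ (accᶠ ⨾ᶠ rightᶠ)}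
      (seq-poly {accᶠ} {leftᶠ} acc-poly left-poly)
      (suc-poly {sucᶠ (accᶠ ⨾ᶠ rightᶠ)} (suc-poly {accᶠ ⨾ᶠ rightᶠ} tail-poly))
      (pair-poly {trueᶠ} {accᶠ ⨾ᶠ rightᶠ} (suc-poly {nilᶠ} nil-poly) tail-poly)))
  right-poly
  where
  tail-poly : PolyTime (accᶠ ⨾ᶠ rightᶠ)
  tail-poly = seq-poly {accᶠ} {rightᶠ} acc-poly right-poly
  grow : ∀ x a m → size (eval halfStepᶠ (node x (node a m))) ≤ 4 + size a + size m
  grow x a m with leftᵗ m
  ... | leaf     = +-monoʳ-≤ 4 (≤-trans (size-rightᵗ m) (m≤n+m (size m) (size a)))
  ... | node _ _ = +-monoʳ-≤ 4 (≤-trans (size-rightᵗ m) (m≤n+m (size m) (size a)))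

-- On a pair of a number k in binary and a number m in unary, decide k < m by deleting the bits of k
-- while halving m.
ltStepᶠ ltᶠ : Fun
ltStepᶠ = ifᶠ itemᶠ accᶠ (accᶠ ⨾ᶠ rightᶠ) ⨾ᶠ halfᶠ
ltᶠ = forᶠ leftᶠ rightᶠ ltStepᶠ

-- Digits come least significant first, and the digit `1+[2_]` turns the value k of the remaining
-- ones into 2k + 1. The digit `2[1+_]` stands for one more, so `ltStepᶠ` lowers `m` by one before
-- halving.
<ᵇ-half : ∀ k m → (k <ᵇ ⌊ m /2⌋) ≡ (suc (2 * k) <ᵇ m)
<ᵇ-half k       zero          = refl
<ᵇ-half k       (suc zero)    = refl
<ᵇ-half zero    (suc (suc m)) = refl
<ᵇ-half (suc k) (suc (suc m)) = trans (<ᵇ-half k m) (cong (_<ᵇ m) (sym (+-suc k (k + 0))))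

eval-lt : ∀ b m → isNode (eval ltᶠ (node (encodeℕᵇ b) (num m))) ≡ (toℕ b <ᵇ m)
eval-lt b₀ m₀ = go b₀ m₀
  where
  step : Tree → Tree → Tree
  step m a = eval ltStepᶠ (node (node (encodeℕᵇ b₀) (num m₀)) (node a m))
  rightᵗ-num : ∀ m → rightᵗ (num m) ≡ num (pred m)
  rightᵗ-num zero    = refl
  rightᵗ-num (suc m) = refl
  go : ∀ b m → isNode (foldl step (num m) (elems (encodeℕᵇ b))) ≡ (toℕ b <ᵇ m)
  go 0ᵇ       zero    = refl
  go 0ᵇ       (suc m) = refl
  go 1+[2 b ] m = begin
    isNode (foldl step (eval halfᶠ (num m)) (elems (encodeℕᵇ b)))
      ≡⟨ cong (λ z → isNode (foldl step z (elems (encodeℕᵇ b)))) (half-num m) ⟩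
    isNode (foldl step (num ⌊ m /2⌋) (elems (encodeℕᵇ b))) ≡⟨ go b ⌊ m /2⌋ ⟩
    (toℕ b <ᵇ ⌊ m /2⌋)                                     ≡⟨ <ᵇ-half (toℕ b) m ⟩
    (suc (2 * toℕ b) <ᵇ m)                                 ∎
    where open ≡-Reasoning
  go 2[1+ b ] m = begin
    isNode (foldl step (eval halfᶠ (rightᵗ (num m))) (elems (encodeℕᵇ b)))
      ≡⟨ cong (λ z → isNode (foldl step z (elems (encodeℕᵇ b))))
              (trans (cong (eval halfᶠ) (rightᵗ-num m)) (half-num (pred m))) ⟩
    isNode (foldl step (num ⌊ pred m /2⌋) (elems (encodeℕᵇ b))) ≡⟨ go b ⌊ pred m /2⌋ ⟩
    (toℕ b <ᵇ ⌊ pred m /2⌋)                                     ≡⟨ <ᵇ-half (toℕ b) (pred m) ⟩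
    (suc (2 * toℕ b) <ᵇ pred m)                                 ≡⟨ <ᵇ-pred (suc (2 * toℕ b)) m ⟩
    (suc (suc (2 * toℕ b)) <ᵇ m)                                ≡⟨ cong (_<ᵇ m) (*-suc 2 (toℕ b)) ⟨
    (2 * suc (toℕ b) <ᵇ m)                                      ∎
    where
    open ≡-Reasoning
    <ᵇ-pred : ∀ k m → (k <ᵇ pred m) ≡ (suc k <ᵇ m)
    <ᵇ-pred k zero    = refl
    <ᵇ-pred k (suc m) = refl

eval-lt-ℕ : ∀ k m → isNode (eval ltᶠ (node (encodeℕ k) (num m))) ≡ (k <ᵇ m)
eval-lt-ℕ k m = trans (eval-lt (fromℕ k) m) (cong (_<ᵇ m) (toℕ-fromℕ k))

lt-poly : PolyTime ltᶠ
lt-poly = for-poly {leftᶠ} {rightᶠ} {ltStepᶠ} 0 grow left-poly right-poly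
  (seq-poly {ifᶠ itemᶠ accᶠ (accᶠ ⨾ᶠ rightᶠ)} {halfᶠ}
    (if-poly {itemᶠ} {accᶠ} {accᶠ ⨾ᶠ rightᶠ} item-poly acc-poly
             (seq-poly {accᶠ} {rightᶠ} acc-poly right-poly))
    half-poly)
  where
  grow : ∀ x a m → size (eval ltStepᶠ (node x (node a m))) ≤ size a + size m
  grow x leaf       m = ≤-trans (size-half (rightᵗ m)) (≤-trans (size-rightᵗ m) (n≤1+n _))
  grow x (node a b) m = ≤-trans (size-half m) (m≤n+m (size m) (size (node a b)))

-- Counting non-adjacent pairs from the adjacency matrix

zeroStepᶠ rowᶠ zerosᶠ : Fun
zeroStepᶠ = ifᶠ itemᶠ accᶠ (sucᶠ accᶠ)
rowᶠ      = forᶠ itemᶠ accᶠ zeroStepᶠ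
zerosᶠ    = forᶠ leftᶠ nilᶠ rowᶠ

zeroStep-grow : ∀ x a m → size (eval zeroStepᶠ (node x (node a m))) ≤ 1 + size a + size m
zeroStep-grow x leaf       m = ≤-refl
zeroStep-grow x (node a b) m = m≤n+m (size m) (suc (size (node a b)))

-- An entry adds at most one plus its size, which is what it contributes to the size of the row; so
-- the inner loop meets the growth condition of the outer one with constant 0.
row-grow : ∀ x a m → size (eval rowᶠ (node x (node a m))) ≤ size a + size m
row-grow x a m = go a m
  where
  go : ∀ l i → size (foldl (λ m b → eval zeroStepᶠ (node (node x (node a m)) (node b m))) i (elems l))
               ≤ size l + size i
  go leaf       i = n≤1+n _
  go (node b l) i = ≤-trans (go l _)
    (≤-trans (+-monoʳ-≤ (size l) (zeroStep-grow x b i)) (≤-reflexive (lemma (size l) (size b) (size i))))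
    where
    lemma : ∀ l b i → l + (1 + b + i) ≡ suc (b + l) + i
    lemma = solve-∀

zeros-poly : PolyTime zerosᶠ
zeros-poly = for-poly {leftᶠ} {nilᶠ} {rowᶠ} 0 row-grow left-poly nil-poly
  (for-poly {itemᶠ} {accᶠ} {zeroStepᶠ} 1 zeroStep-grow item-poly acc-poly
    (if-poly {itemᶠ} {accᶠ} {sucᶠ accᶠ} item-poly acc-poly (suc-poly {accᶠ} acc-poly)))

eval-zeros : ∀ G t → eval zerosᶠ (node (encodeGraph G) t)
                   ≡ num (length (filter (uncurry (nonEdge? G)) (pairs (Graph.order G))))
eval-zeros G t = begin
  foldl (λ m a → eval rowᶠ (node x (node a m))) leaf (elems (encodeGraph G))
    ≡⟨ foldl-encodeList (λ m a → eval rowᶠ (node x (node a m))) (encodeList encodeBool) leaf (adjacencyMatrix G) ⟩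
  foldl (λ m r → eval rowᶠ (node x (node (encodeList encodeBool r) m))) leaf (adjacencyMatrix G)
    ≡⟨ foldl-map (λ m r → eval rowᶠ (node x (node (encodeList encodeBool r) m)))
                 (λ u → map (λ v → does (u ~? v)) (allFin order)) leaf (allFin order) ⟩
  foldl (λ m u → eval rowᶠ (node x (node (encodeList encodeBool (map (λ v → does (u ~? v)) (allFin order))) m)))
        leaf (allFin order)
    ≡⟨ foldl-cong row leaf (allFin order) ⟩
  foldl (λ m u → foldl (λ m v → step m (u , v)) m (allFin order)) leaf (allFin order)
    ≡⟨ foldl-cartesianProduct step leaf (allFin order) (allFin order) ⟩
  foldl step leaf (pairs order)
    ≡⟨ foldl-count (uncurry (nonEdge? G)) count 0 (pairs order) ⟩
  num (length (filter (uncurry (nonEdge? G)) (pairs order))) ∎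
  where
  open ≡-Reasoning
  open Graph G
  x = node (encodeGraph G) t
  bitStep : Tree → Bool → Tree
  bitStep m b = ifᵇ isNode (encodeBool b) then m else node leaf m
  step : Tree → Vertex × Vertex → Tree
  step m (u , v) = bitStep m (does (u ~? v))
  row : ∀ m u → eval rowᶠ (node x (node (encodeList encodeBool (map (λ v → does (u ~? v)) (allFin order))) m))
              ≡ foldl (λ m v → step m (u , v)) m (allFin order)
  row m u = trans
    (foldl-encodeList (λ m a → ifᵇ isNode a then m else node leaf m) encodeBool m
                      (map (λ v → does (u ~? v)) (allFin order)))
    (foldl-map bitStep (λ v → does (u ~? v)) m (allFin order))
  count : ∀ m p → step (num m) p ≡ (ifᵇ does (uncurry (nonEdge? G) p) then num (suc m) else num m)
  count m (u , v) with does (u ~? v)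
  ... | true  = refl
  ... | false = refl

offDiagonalᶠ largeᶠ enoughᶠ : Fun
offDiagonalᶠ = forᶠ leftᶠ zerosᶠ (accᶠ ⨾ᶠ rightᶠ)
-- k < ⌊(n + 3) / 4⌋, that is, 4 k < n
largeᶠ       = pairᶠ rightᶠ (sucᶠ (sucᶠ (sucᶠ leftᶠ)) ⨾ᶠ halfᶠ ⨾ᶠ halfᶠ) ⨾ᶠ ltᶠ
enoughᶠ      = pairᶠ rightᶠ (sucᶠ (sucᶠ offDiagonalᶠ) ⨾ᶠ halfᶠ) ⨾ᶠ ltᶠ

offDiagonal-poly : PolyTime offDiagonalᶠ
offDiagonal-poly = for-poly {leftᶠ} {zerosᶠ} {accᶠ ⨾ᶠ rightᶠ} 0
  (λ x a m → ≤-trans (size-rightᵗ m) (m≤n+m (size m) (size a)))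
  left-poly zeros-poly (seq-poly {accᶠ} {rightᶠ} acc-poly right-poly)

large-poly : PolyTime largeᶠ
large-poly = seq-poly {pairᶠ rightᶠ L} {ltᶠ}
  (pair-poly {rightᶠ} {L} right-poly
    (seq-poly {sucᶠ (sucᶠ (sucᶠ leftᶠ))} {halfᶠ ⨾ᶠ halfᶠ}
      (suc-poly {sucᶠ (sucᶠ leftᶠ)} (suc-poly {sucᶠ leftᶠ} (suc-poly {leftᶠ} left-poly)))
      (seq-poly {halfᶠ} {halfᶠ} half-poly half-poly)))
  lt-poly
  where L = sucᶠ (sucᶠ (sucᶠ leftᶠ)) ⨾ᶠ halfᶠ ⨾ᶠ halfᶠ

enough-poly : PolyTime enoughᶠ
enough-poly = seq-poly {pairᶠ rightᶠ L} {ltᶠ}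
  (pair-poly {rightᶠ} {L} right-poly
    (seq-poly {sucᶠ (sucᶠ offDiagonalᶠ)} {halfᶠ}
      (suc-poly {sucᶠ offDiagonalᶠ} (suc-poly {offDiagonalᶠ} offDiagonal-poly)) half-poly))
  lt-poly
  where L = sucᶠ (sucᶠ offDiagonalᶠ) ⨾ᶠ halfᶠ

-- One unit is removed per row, which cancels the zeros on the diagonal; each unordered pair is
-- still counted twice.
eval-offDiagonal : ∀ G t → eval offDiagonalᶠ (node (encodeGraph G) t) ≡ num (2 * length (nonEdges G))
eval-offDiagonal G t = begin
  foldl (λ m _ → rightᵗ m) (eval zerosᶠ x) (elems (encodeGraph G))
    ≡⟨ cong₂ (foldl (λ m _ → rightᵗ m)) (trans (eval-zeros G t) (cong num (count-nonEdges G)))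
             (elems-encodeList (encodeList encodeBool) (adjacencyMatrix G)) ⟩
  foldl (λ m _ → rightᵗ m) (num (N + order)) rows
    ≡⟨ cong (λ k → foldl (λ m _ → rightᵗ m) (num (N + k)) rows) length-rows ⟨
  foldl (λ m _ → rightᵗ m) (num (N + length rows)) rows
    ≡⟨ drop N rows ⟩
  num N ∎
  where
  open ≡-Reasoning
  open Graph G
  x = node (encodeGraph G) t
  N = 2 * length (nonEdges G)
  rows = map (encodeList encodeBool) (adjacencyMatrix G)
  length-rows : length rows ≡ order
  length-rows = trans (length-map _ (adjacencyMatrix G)) (trans (length-map _ (allFin order)) (length-tabulate id))
  drop : ∀ n (as : List Tree) → foldl (λ m _ → rightᵗ m) (num (n + length as)) as ≡ num n
  drop n []       = cong num (+-identityʳ n)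
  drop n (a ∷ as) = trans (cong (λ k → foldl (λ m _ → rightᵗ m) (rightᵗ (num k)) as) (+-suc n (length as)))
                          (drop n as)

length-encodeGraph : ∀ G → length (elems (encodeGraph G)) ≡ Graph.order G
length-encodeGraph G = trans (cong length (elems-encodeList (encodeList encodeBool) (adjacencyMatrix G)))
  (trans (length-map _ (adjacencyMatrix G)) (trans (length-map _ (allFin (Graph.order G))) (length-tabulate id)))

eval-large : ∀ G k → isNode (eval largeᶠ (node (encodeGraph G) (encodeℕ k))) ≡ (4 * k <ᵇ Graph.order G)
eval-large G k = begin
  isNode (eval ltᶠ (node (encodeℕ k) (eval halfᶠ (eval halfᶠ M))))
    ≡⟨ cong (λ z → isNode (eval ltᶠ (node (encodeℕ k) z)))
            (trans (cong (eval halfᶠ) (trans (eval-half M)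
                     (cong (λ m → num ⌊ 3 + m /2⌋) (length-encodeGraph G))))
                   (half-num ⌊ 3 + n /2⌋)) ⟩
  isNode (eval ltᶠ (node (encodeℕ k) (num ⌊ ⌊ 3 + n /2⌋ /2⌋)))
    ≡⟨ eval-lt-ℕ k ⌊ ⌊ 3 + n /2⌋ /2⌋ ⟩
  (k <ᵇ ⌊ ⌊ 3 + n /2⌋ /2⌋)                  ≡⟨ <ᵇ-half k ⌊ 3 + n /2⌋ ⟩
  (suc (2 * k) <ᵇ ⌊ 3 + n /2⌋)              ≡⟨ <ᵇ-half (suc (2 * k)) (3 + n) ⟩
  (suc (2 * suc (2 * k)) <ᵇ 3 + n)          ≡⟨ cong (_<ᵇ 3 + n) (lemma k) ⟩
  (4 * k <ᵇ n)                              ∎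
  where
  open ≡-Reasoning
  n = Graph.order G
  -- Halving looks only at the number of entries, so three leaves in front of the list of rows act
  -- as n + 3.
  M = node leaf (node leaf (node leaf (encodeGraph G)))
  lemma : ∀ k → suc (2 * suc (2 * k)) ≡ 3 + 4 * k
  lemma = solve-∀

-- Adding 2 before halving the doubled count gives the count plus one, which turns the strict
-- comparison of `ltᶠ` into a weak one.
eval-enough : ∀ G k → isNode (eval enoughᶠ (node (encodeGraph G) (encodeℕ k))) ≡ (k <ᵇ suc (length (nonEdges G)))
eval-enough G k = begin
  isNode (eval ltᶠ (node (encodeℕ k) (eval halfᶠ (node leaf (node leaf (eval offDiagonalᶠ x))))))
    ≡⟨ cong (λ z → isNode (eval ltᶠ (node (encodeℕ k) (eval halfᶠ (node leaf (node leaf z)))))) (eval-offDiagonal G (encodeℕ k)) ⟩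
  isNode (eval ltᶠ (node (encodeℕ k) (eval halfᶠ (num (2 + 2 * A′)))))
    ≡⟨ cong (λ z → isNode (eval ltᶠ (node (encodeℕ k) z))) (half-num (2 + 2 * A′)) ⟩
  isNode (eval ltᶠ (node (encodeℕ k) (num (suc ⌊ 2 * A′ /2⌋))))
    ≡⟨ eval-lt-ℕ k (suc ⌊ 2 * A′ /2⌋) ⟩
  (k <ᵇ suc ⌊ 2 * A′ /2⌋)
    ≡⟨ cong (λ m → k <ᵇ suc m) (trans (cong (λ m → ⌊ A′ + m /2⌋) (+-identityʳ A′)) (sym (n≡⌊n+n/2⌋ A′))) ⟩
  (k <ᵇ suc A′) ∎
  where
  open ≡-Reasoning
  x = node (encodeGraph G) (encodeℕ k)
  A′ = length (nonEdges G)

-- The trivial instances and the kernel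

star : ℕ → Graph
star n = record
  { order    = suc n
  ; _~_      = λ u v → u ≢ v × (u ≡ zero ⊎ v ≡ zero)
  ; _~?_     = λ u v → ¬? (u Fin.≟ v) ×-dec ((u Fin.≟ zero) ⊎-dec (v Fin.≟ zero))
  ; ~-sym    = λ { (u≢v , inj₁ eq) → ≢-sym u≢v , inj₂ eq ; (u≢v , inj₂ eq) → ≢-sym u≢v , inj₁ eq }
  ; ~-irrefl = λ { refl (u≢u , _) → u≢u refl }
  }

star-connected : ∀ n → Graph.Connected (star n)
star-connected n = s≤s z≤n , λ u v → toCentre u ◅◅ fromCentre v
  where
  open Graph (star n) using (Walk)
  toCentre : ∀ u → Walk u zero
  toCentre zero    = ε
  toCentre (suc u) = ((λ ()) , inj₂ refl) ◅ ε
  fromCentre : ∀ u → Walk zero u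
  fromCentre zero    = ε
  fromCentre (suc u) = ((λ ()) , inj₁ refl) ◅ ε

-- `n` = 2 is the path on three vertices, a yes-instance through its single non-adjacent pair; `n` =
-- 0 is a point, a no-instance. Both fit below 4k for every positive k.
starInstance : ℕ → RainbowInstance
starInstance n = record { graph = star n ; connected = star-connected n ; k = 1 ; k>0 = s≤s z≤n }

path-yes : TwoColourable (starInstance 2)
path-yes = fromSolution (star 2) record
  { c = c ; c-sym = λ u v → Bool.xor-comm (s u) (s v) ; many = s≤s z≤n }
  where
  s : Fin 3 → Bool
  s v = does (v Fin.≟ suc zero)
  c : Fin 3 → Fin 3 → Bool
  c u v = s u xor s v

point-no : ¬ TwoColourable (starInstance 0)
point-no (c , p) with Solution.many (toSolution (star 0) c p)
... | ()

open ParameterizedProblem MaxRainbow2Colouring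

yesᶠ noᶠ largeCaseᶠ kernelᶠ : Fun
yesᶠ       = constᶠ (encode (starInstance 2))
noᶠ        = constᶠ (encode (starInstance 0))
largeCaseᶠ = ifᶠ enoughᶠ yesᶠ noᶠ
kernelᶠ    = ifᶠ largeᶠ largeCaseᶠ idᶠ

kernel-poly : PolyTime kernelᶠ
kernel-poly = if-poly {largeᶠ} {largeCaseᶠ} {idᶠ} large-poly
  (if-poly {enoughᶠ} {yesᶠ} {noᶠ} enough-poly
    (const-poly (encode (starInstance 2))) (const-poly (encode (starInstance 0)))) id-poly

yes-large : ∀ x → let open RainbowInstance x in 4 * k < order → TwoColourable x ⇔ k ≤ length (nonEdges graph)
yes-large x large = mk⇔
  (λ (c , p) → let sol = toSolution graph c p in
     ≤-trans (Solution.many sol) (satisfied-≤ graph (Solution.c sol)))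
  (λ k≤ → fromSolution graph (solve-large graph connected large k≤))
  where open RainbowInstance x

KernelisedTo : Instance → Tree → Set₁
KernelisedTo x z = Σ[ y ∈ Instance ] z ≡ encode y
  × (Yes x ⇔ Yes y) × RainbowInstance.order y ≤ 4 * parameter x × parameter y ≤ parameter x

kernelise : ∀ x → KernelisedTo x (eval kernelᶠ (encode x))
kernelise x with 4 * RainbowInstance.k x <? RainbowInstance.order x
                | RainbowInstance.k x <? suc (length (nonEdges (RainbowInstance.graph x)))
... | no ¬large | _ = x ,
  eval-if-false largeᶠ largeCaseᶠ idᶠ (encode x) (trans (eval-large graph k) (dec-false (4 * k <? order) ¬large)) ,
  mk⇔ id id , ≮⇒≥ ¬large , ≤-refl
  where open RainbowInstance x
... | yes large | yes enough = starInstance 2 ,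
  trans (eval-if-true largeᶠ largeCaseᶠ idᶠ (encode x) (trans (eval-large graph k) (dec-true (4 * k <? order) large)))
    (trans (eval-if-true enoughᶠ yesᶠ noᶠ (encode x) (trans (eval-enough graph k) (dec-true (k <? _) enough)))
           (eval-const (encode (starInstance 2)) (encode x))) ,
  mk⇔ (λ _ → path-yes) (λ _ → Equivalence.from (yes-large x large) (s≤s⁻¹ enough)) ,
  ≤-trans (s≤s (s≤s (s≤s z≤n))) (*-monoʳ-≤ 4 k>0) , k>0
  where open RainbowInstance x
... | yes large | no ¬enough = starInstance 0 ,
  trans (eval-if-true largeᶠ largeCaseᶠ idᶠ (encode x) (trans (eval-large graph k) (dec-true (4 * k <? order) large)))
    (trans (eval-if-false enoughᶠ yesᶠ noᶠ (encode x) (trans (eval-enough graph k) (dec-false (k <? _) ¬enough)))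
           (eval-const (encode (starInstance 0)) (encode x))) ,
  mk⇔ (λ y → contradiction (s≤s (Equivalence.to (yes-large x large) y)) ¬enough)
      (λ y → contradiction y point-no) ,
  ≤-trans (s≤s z≤n) (*-monoʳ-≤ 4 k>0) , k>0
  where open RainbowInstance x

-- Sizes are positive, so 1 + `size x` is at most twice `size x`, and the power of 2 becomes the
-- constant.
poly-time-bound : ∀ F → PolyTime F → Σ[ c ∈ ℕ ] Σ[ d ∈ ℕ ] ∀ x → time F x ≤ c * size x ^ d
poly-time-bound F (e , bound) = 2 ^ e , e , λ x → begin
  time F x             ≤⟨ bound x ⟩
  suc (size x) ^ e     ≤⟨ ^-monoˡ-≤ e (+-mono-≤ (1≤size x) (m≤m+n (size x) 0)) ⟩
  (2 * size x) ^ e     ≡⟨ ^-distribʳ e 2 (size x) ⟩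
  2 ^ e * size x ^ e   ∎
  where
  open ≤-Reasoning
  ^-distribʳ : ∀ e m n → (m * n) ^ e ≡ m ^ e * n ^ e
  ^-distribʳ zero    m n = refl
  ^-distribʳ (suc e) m n = trans (cong (m * n *_) (^-distribʳ e m n)) ([m*n]*[o*p]≡[m*o]*[n*p] m n (m ^ e) (n ^ e))

polyTime-kernel : ∀ F → PolyTime F → (∀ x → KernelisedTo x (eval F (encode x))) →
                  HasKernel RainbowInstance.order (λ k → 4 * k)
polyTime-kernel F poly kernelises with poly-time-bound F poly
... | c , d , bound = compile F , c , d , id , λ x →
  let y , eq , iff , small , par = kernelises x
      t , r = run F (encode x)
  in y , t , subst (λ z → compile F ∙ encode x ⇓ z ⟨ t ⟩) eq r , bound (encode x) , iff , small , par

kernel : HasKernel RainbowInstance.order (λ k → 4 * k)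
kernel = polyTime-kernel kernelᶠ kernel-poly kernelise

-- Exhaustive search

private variable
  n : ℕ

-- A tree whose list of entries is full (n - 1), …, full 0; it represents the vertex number n.
full : ℕ → Tree
full zero    = leaf
full (suc n) = node (full n) (full n)

elems-full : ∀ n → elems (full n) ≡ map full (downFrom n)
elems-full zero    = refl
elems-full (suc n) = cong (full n ∷_) (elems-full n)

length-elems-full : ∀ n → length (elems (full n)) ≡ n
length-elems-full n = trans (cong length (elems-full n)) (trans (length-map full (downFrom n)) (length-downFrom n))

descending : ∀ n → List (Fin n)
descending n = reverse (allFin n)

map-toℕ-descending : ∀ n → map Fin.toℕ (descending n) ≡ downFrom n
map-toℕ-descending n = begin
  map Fin.toℕ (reverse (allFin n)) ≡⟨ reverse-map Fin.toℕ (allFin n) ⟩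
  reverse (map Fin.toℕ (allFin n)) ≡⟨ cong reverse (trans (map-tabulate id Fin.toℕ) (go n id)) ⟩
  reverse (upTo n)                 ≡⟨ reverse-upTo n ⟩
  downFrom n                       ∎
  where
  open ≡-Reasoning
  go : ∀ n (f : ℕ → ℕ) → tabulate {n = n} (f ∘ Fin.toℕ) ≡ applyUpTo f n
  go zero    f = refl
  go (suc n) f = cong (f 0 ∷_) (go n (f ∘ suc))

descending-unique : ∀ n → Unique (descending n)
descending-unique n = Unique.map⁻ (subst Unique (sym (map-toℕ-descending n)) (Unique.downFrom⁺ n))

∈-descending : (u : Fin n) → u ∈ descending n
∈-descending {n} u
  with ∈-map⁻ Fin.toℕ (subst (Fin.toℕ u ∈_) (sym (map-toℕ-descending n)) (∈-downFrom⁺ (Fin.toℕ<n u)))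
... | v , v∈ , eq = subst (_∈ descending n) (sym (Fin.toℕ-injective eq)) v∈

vertex : Fin n → Tree
vertex u = full (Fin.toℕ u)

foldl-vertices : (g : B → Tree → B) → ∀ m → foldl g m (elems (full n)) ≡ foldl (λ m u → g m (vertex u)) m (descending n)
foldl-vertices {n = n} g m = trans
  (cong (foldl g m) (trans (elems-full n) (trans (cong (map full) (sym (map-toℕ-descending n)))
                                                 (sym (map-∘ (descending n))))))
  (foldl-map g vertex m (descending n))

-- The index is the number of entries of `i`, so vertices coded by `full` serve as indices. Reading
-- past the end yields `leaf`, that is, false, which gives arbitrary trees a meaning as matrices.
nth : Tree → Tree → Tree
nth i l = leftᵗ (foldl (λ m _ → rightᵗ m) l (elems i))

nthᶠ : Fun → Fun → Fun
nthᶠ I L = forᶠ I L (accᶠ ⨾ᶠ rightᶠ) ⨾ᶠ leftᶠ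

nth-encodeList : (f : A → Tree) (g : Fin n → A) (u : Fin n) → nth (vertex u) (encodeList f (tabulate g)) ≡ f (g u)
nth-encodeList {A} f g u = go g u (elems (vertex u)) (length-elems-full (Fin.toℕ u))
  where
  go : ∀ {n} (g : Fin n → A) u (as : List Tree) → length as ≡ Fin.toℕ u →
       leftᵗ (foldl (λ m _ → rightᵗ m) (encodeList f (tabulate g)) as) ≡ f (g u)
  go g zero    []       _  = refl
  go g (suc u) (_ ∷ as) eq = go (g ∘ suc) u as (suc-injective eq)

-- For the adjacency test as `h` this is `encodeGraph` by definition, so graphs and colourings are
-- read in the same way.
encodeMatrix : (Fin n → Fin n → Bool) → Tree
encodeMatrix {n} h = encodeList (encodeList encodeBool) (map (λ u → map (h u) (allFin n)) (allFin n))

entry : Tree → Tree → Tree → Tree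
entry M u v = nth v (nth u M)

entryᶠ : Fun → Fun → Fun → Fun
entryᶠ M U V = nthᶠ V (nthᶠ U M)

entry-matrix : (h : Fin n → Fin n → Bool) → ∀ u v → entry (encodeMatrix h) (vertex u) (vertex v) ≡ encodeBool (h u v)
entry-matrix {n} h u v = begin
  nth (vertex v) (nth (vertex u) (encodeList (encodeList encodeBool) (map (λ u → map (h u) (allFin n)) (allFin n))))
    ≡⟨ cong (λ r → nth (vertex v) (nth (vertex u) (encodeList (encodeList encodeBool) r))) (map-tabulate id _) ⟩
  nth (vertex v) (nth (vertex u) (encodeList (encodeList encodeBool) (tabulate (λ u → map (h u) (allFin n)))))
    ≡⟨ cong (nth (vertex v)) (nth-encodeList (encodeList encodeBool) _ u) ⟩
  nth (vertex v) (encodeList encodeBool (map (h u) (allFin n)))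
    ≡⟨ cong (λ r → nth (vertex v) (encodeList encodeBool r)) (map-tabulate id (h u)) ⟩
  nth (vertex v) (encodeList encodeBool (tabulate (h u)))
    ≡⟨ nth-encodeList encodeBool (h u) v ⟩
  encodeBool (h u v) ∎
  where open ≡-Reasoning

isNode-encodeBool : ∀ b → isNode (encodeBool b) ≡ b
isNode-encodeBool false = refl
isNode-encodeBool true  = refl

-- Listing all trees of bounded depth

depth : Tree → ℕ
depth leaf       = 0
depth (node l r) = suc (depth l ⊔ depth r)

depth-encodeList : (f : A → Tree) → ∀ {d} → (∀ x → depth (f x) ≤ d) → ∀ xs → depth (encodeList f xs) ≤ length xs + d
depth-encodeList f f≤ []       = z≤n
depth-encodeList f {d} f≤ (x ∷ xs) = s≤s (⊔-lub (m≤n⇒m≤o+n (length xs) (f≤ x)) (depth-encodeList f f≤ xs))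

-- The initial value is the list with the single entry `leaf`; to it are added all nodes with both
-- subtrees from the given list. This raises the depth covered by one.
nextᶠ : Fun
nextᶠ = forᶠ idᶠ trueᶠ (forᶠ leftᶠ accᶠ (pairᶠ (pairᶠ (leftᶠ ⨾ᶠ itemᶠ) itemᶠ) accᶠ))

foldl-∈ : {f : Tree → A → Tree} {t : Tree} → (∀ m a → t ∈ elems m → t ∈ elems (f m a)) →
          ∀ {m} as → t ∈ elems m → t ∈ elems (foldl f m as)
foldl-∈ keep []       t∈ = t∈
foldl-∈ keep (a ∷ as) t∈ = foldl-∈ keep as (keep _ a t∈)

foldl-∈-new : {f : Tree → A → Tree} {t : Tree} → (∀ m a → t ∈ elems m → t ∈ elems (f m a)) →
              ∀ {a m as} → a ∈ as → (∀ m → t ∈ elems (f m a)) → t ∈ elems (foldl f m as)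
foldl-∈-new keep {m = m} {as = _ ∷ as} (here refl) new = foldl-∈ keep as (new m)
foldl-∈-new keep (there a∈) new = foldl-∈-new keep a∈ new

next-keep : ∀ {t} l m a → t ∈ elems m →
            t ∈ elems (foldl (λ m b → node (node a b) m) m (elems l))
next-keep l m a = foldl-∈ (λ _ _ → there) (elems l)

leaf∈next : ∀ l → leaf ∈ elems (eval nextᶠ l)
leaf∈next l = foldl-∈ (next-keep l) (elems l) (here refl)

node∈next : ∀ {a b} l → a ∈ elems l → b ∈ elems l → node a b ∈ elems (eval nextᶠ l)
node∈next l a∈ b∈ = foldl-∈-new (next-keep l) a∈ λ m →
  foldl-∈-new {f = λ m b → node (node _ b) m} (λ _ _ → there) b∈ (λ _ → here refl)

trees : ℕ → Tree
trees zero    = node leaf leaf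
trees (suc d) = eval nextᶠ (trees d)

∈-trees : ∀ {d} t → depth t ≤ d → t ∈ elems (trees d)
∈-trees {zero}  leaf       _        = here refl
∈-trees {suc d} leaf       _        = leaf∈next (trees d)
∈-trees {suc d} (node l r) (s≤s le) = node∈next (trees d)
  (∈-trees l (≤-trans (m≤m⊔n (depth l) (depth r)) le)) (∈-trees r (≤-trans (m≤n⊔m (depth l) (depth r)) le))

-- Two rounds of `nextᶠ` per row and a final one reach depth 2n + 1, enough for every n by n bit
-- matrix: n for the list of rows, n for a row and 1 for a bit.
coloursᶠ verticesᶠ : Fun
coloursᶠ  = forᶠ leftᶠ trueᶠ (accᶠ ⨾ᶠ nextᶠ ⨾ᶠ nextᶠ) ⨾ᶠ nextᶠ
verticesᶠ = forᶠ leftᶠ nilᶠ (pairᶠ accᶠ accᶠ)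

foldl-trees : ∀ d (as : List A) → foldl (λ m _ → eval nextᶠ (eval nextᶠ m)) (trees d) as ≡ trees (2 * length as + d)
foldl-trees d []       = refl
foldl-trees d (a ∷ as) = trans (foldl-trees (2 + d) as) (cong trees (lemma (length as) d))
  where
  lemma : ∀ l d → 2 * l + (2 + d) ≡ 2 * suc l + d
  lemma = solve-∀

foldl-full : ∀ d (as : List A) → foldl (λ m _ → node m m) (full d) as ≡ full (length as + d)
foldl-full d []       = refl
foldl-full d (a ∷ as) = trans (foldl-full (suc d) as) (cong full (+-suc (length as) d))

eval-vertices : ∀ G t → eval verticesᶠ (node (encodeGraph G) t) ≡ full (Graph.order G)
eval-vertices G t = trans (foldl-full 0 (elems (encodeGraph G)))
  (cong full (trans (+-identityʳ _) (length-encodeGraph G)))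

eval-colours : ∀ G t → eval coloursᶠ (node (encodeGraph G) t) ≡ trees (suc (2 * Graph.order G))
eval-colours G t = cong (eval nextᶠ) (trans (foldl-trees 0 (elems (encodeGraph G)))
  (cong trees (trans (+-identityʳ _) (cong (2 *_) (length-encodeGraph G)))))

depth-matrix : (h : Fin n → Fin n → Bool) → depth (encodeMatrix h) ≤ suc (2 * n)
depth-matrix {n} h = begin
  depth (encodeMatrix h)
    ≡⟨ cong depth (encodeList-map (allFin n)) ⟩
  depth (encodeList (λ u → encodeList encodeBool (map (h u) (allFin n))) (allFin n))
    ≤⟨ depth-encodeList _ (λ u → ≤-trans (depth-encodeList encodeBool depth-bool (map (h u) (allFin n))) (row u)) (allFin n) ⟩
  length (allFin n) + (n + 1) ≡⟨ cong (_+ (n + 1)) (length-tabulate {n = n} id) ⟩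
  n + (n + 1)                 ≡⟨ lemma n ⟩
  suc (2 * n)                 ∎
  where
  open ≤-Reasoning
  depth-bool : ∀ b → depth (encodeBool b) ≤ 1
  depth-bool false = z≤n
  depth-bool true  = ≤-refl
  row : ∀ u → length (map (h u) (allFin n)) + 1 ≤ n + 1
  row u = ≤-reflexive (cong (_+ 1) (trans (length-map (h u) (allFin n)) (length-tabulate {n = n} id)))
  encodeList-map : ∀ {A B : Set} {f : B → Tree} {g : A → B} xs → encodeList f (map g xs) ≡ encodeList (f ∘ g) xs
  encodeList-map []       = refl
  encodeList-map (x ∷ xs) = cong (node _) (encodeList-map xs)
  lemma : ∀ n → n + (n + 1) ≡ suc (2 * n)
  lemma = solve-∀

-- Testing the colouring described by a tree

notᶠ : Fun → Fun
notᶠ F = ifᶠ F nilᶠ trueᶠ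

andᶠ xorᶠ : Fun → Fun → Fun
andᶠ F G = ifᶠ F G nilᶠ
xorᶠ F G = ifᶠ F (notᶠ G) G

isNode-not : ∀ F x → isNode (eval (notᶠ F) x) ≡ not (isNode (eval F x))
isNode-not F x with isNode (eval F x)
... | false = refl
... | true  = refl

isNode-and : ∀ F G x → isNode (eval (andᶠ F G) x) ≡ isNode (eval F x) ∧ isNode (eval G x)
isNode-and F G x with isNode (eval F x)
... | false = refl
... | true  = refl

isNode-xor : ∀ F G x → isNode (eval (xorᶠ F G) x) ≡ isNode (eval F x) xor isNode (eval G x)
isNode-xor F G x with isNode (eval F x)
... | false = refl
... | true  = isNode-not G x

-- The conjunction of both orientations turns any tree into a symmetric colouring and reproduces a
-- symmetric matrix, so every candidate is valid and every solution is found.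
colourᶠ : Fun → Fun → Fun → Fun
colourᶠ C U V = andᶠ (entryᶠ C U V) (entryᶠ C V U)

treeColour : Tree → Fin n → Fin n → Bool
treeColour C u v = isNode (entry C (vertex u) (vertex v)) ∧ isNode (entry C (vertex v) (vertex u))

-- The loop variables: a colour matrix C, vertices u and v, and a middle vertex w.
middleᶠ linkedᶠ satisfiedᶠ countᶠ testᶠ searchᶠ bruteᶠ : Fun
middleᶠ = andᶠ (entryᶠ M u w) (andᶠ (entryᶠ M w v) (xorᶠ (colourᶠ C u w) (colourᶠ C w v)))
  where
  M = leftᶠ ⨾ᶠ leftᶠ ⨾ᶠ leftᶠ ⨾ᶠ leftᶠ ⨾ᶠ leftᶠ
  C = leftᶠ ⨾ᶠ leftᶠ ⨾ᶠ leftᶠ ⨾ᶠ itemᶠ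
  u = leftᶠ ⨾ᶠ leftᶠ ⨾ᶠ itemᶠ
  v = leftᶠ ⨾ᶠ itemᶠ
  w = itemᶠ
linkedᶠ = andᶠ (notᶠ (entryᶠ (leftᶠ ⨾ᶠ leftᶠ ⨾ᶠ leftᶠ ⨾ᶠ leftᶠ) (leftᶠ ⨾ᶠ itemᶠ) itemᶠ))
               (forᶠ (leftᶠ ⨾ᶠ leftᶠ ⨾ᶠ leftᶠ ⨾ᶠ verticesᶠ) nilᶠ (ifᶠ middleᶠ (sucᶠ accᶠ) accᶠ))
satisfiedᶠ = andᶠ (forᶠ (leftᶠ ⨾ᶠ itemᶠ) itemᶠ (accᶠ ⨾ᶠ rightᶠ)) linkedᶠ
countᶠ = forᶠ (leftᶠ ⨾ᶠ verticesᶠ) nilᶠ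
              (forᶠ (leftᶠ ⨾ᶠ leftᶠ ⨾ᶠ verticesᶠ) accᶠ (ifᶠ satisfiedᶠ (sucᶠ accᶠ) accᶠ))
testᶠ = pairᶠ (leftᶠ ⨾ᶠ rightᶠ) (sucᶠ countᶠ) ⨾ᶠ ltᶠ
searchᶠ = forᶠ coloursᶠ nilᶠ (ifᶠ testᶠ (sucᶠ accᶠ) accᶠ)
bruteᶠ = ifᶠ searchᶠ trueᶠ nilᶠ

tally : ∀ {P : U.Pred A 0ℓ} (P? : U.Decidable P) {F : Fun} {x : Tree} {h : A → Tree} →
        (∀ m a → isNode (eval F (node x (node (h a) m))) ≡ does (P? a)) → ∀ m as →
        foldl (λ m a → eval (ifᶠ F (sucᶠ accᶠ) accᶠ) (node x (node (h a) m))) (num m) as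
        ≡ num (m + length (filter P? as))
tally P? F≡ = foldl-count P? (λ m a → cong (λ b → ifᵇ b then num (suc m) else num m) (F≡ (num m) a))

nonempty-filter : ∀ {P : U.Pred A 0ℓ} (P? : U.Decidable P) xs →
                  Reflects (Σ[ x ∈ A ] x ∈ xs × P x) (isNode (num (length (filter P? xs))))
nonempty-filter P? xs with filter P? xs in eq
... | y ∷ _ = ofʸ (_ , ∈-filter⁻ P? (subst (y ∈_) (sym eq) (here refl)))
... | []    = ofⁿ λ (x , x∈ , Px) → contradiction (subst (x ∈_) eq (∈-filter⁺ P? x∈ Px)) λ ()

-- The inner loop carries the outer accumulator in its environment and is known only through the
-- count it returns, so the hypothesis speaks of whole rows.
foldl-count-product : ∀ {P : U.Pred (A × B) 0ℓ} (P? : U.Decidable P) {f : Tree → A → Tree} {vs} →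
  (∀ m u → f (num m) u ≡ num (m + length (filter (λ v → P? (u , v)) vs))) →
  ∀ m us → foldl f (num m) us ≡ num (m + length (filter P? (cartesianProduct us vs)))
foldl-count-product P? f≡ m [] = cong num (sym (+-identityʳ m))
foldl-count-product P? {f} {vs} f≡ m (u ∷ us) = begin
  foldl f (f (num m) u) us
    ≡⟨ cong (λ z → foldl f z us) (f≡ m u) ⟩
  foldl f (num (m + length (filter (λ v → P? (u , v)) vs))) us
    ≡⟨ foldl-count-product P? f≡ _ us ⟩
  num (m + length (filter (λ v → P? (u , v)) vs) + length (filter P? (cartesianProduct us vs)))
    ≡⟨ cong num (+-assoc m _ _) ⟩
  num (m + (length (filter (λ v → P? (u , v)) vs) + length (filter P? (cartesianProduct us vs))))
    ≡⟨ cong (λ l → num (m + (l + length (filter P? (cartesianProduct us vs))))) (row vs) ⟨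
  num (m + (length (filter P? (map (u ,_) vs)) + length (filter P? (cartesianProduct us vs))))
    ≡⟨ cong (λ l → num (m + l)) (trans (cong length (filter-++ P? (map (u ,_) vs) _))
                                       (length-++ (filter P? (map (u ,_) vs)))) ⟨
  num (m + length (filter P? (cartesianProduct (u ∷ us) vs))) ∎
  where
  open ≡-Reasoning
  row : ∀ vs → length (filter P? (map (u ,_) vs)) ≡ length (filter (λ v → P? (u , v)) vs)
  row [] = refl
  row (v ∷ vs) with does (P? (u , v))
  ... | true  = cong suc (row vs)
  ... | false = row vs

reflects-does : ∀ {P Q : Set} {b} → (P → Q) → (Q → P) → Reflects P b → (Q? : Dec Q) → b ≡ does Q?
reflects-does to from (ofʸ p)  Q? = sym (dec-true Q? (to p))
reflects-does to from (ofⁿ ¬p) Q? = sym (dec-false Q? (¬p ∘ from))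

module _ (G : Graph) (t C m₀ : Tree) where
  open Graph G

  private
    M = encodeGraph G
    x = node M t
    c = treeColour {order} C
    -- `e₁`, `e₂` and `e₃` are the environments inside one, two and three nested loops, each
    -- recording the entry visited and the accumulator at that moment.
    e₁ = node x (node C m₀)
    e₂ : Vertex → Tree → Tree
    e₂ u m = node e₁ (node (vertex u) m)
    e₃ : Vertex → Tree → Vertex → Tree → Tree
    e₃ u m v m′ = node (e₂ u m) (node (vertex v) m′)

  isNode-edge : ∀ u v → isNode (entry M (vertex u) (vertex v)) ≡ does (u ~? v)
  isNode-edge u v = trans (cong isNode (entry-matrix (λ u v → does (u ~? v)) u v)) (isNode-encodeBool _)

  colour-eval : ∀ {F U V y} u v → eval F y ≡ C → eval U y ≡ vertex u → eval V y ≡ vertex v →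
                isNode (eval (colourᶠ F U V) y) ≡ c u v
  colour-eval {F} {U} {V} {y} u v F≡ U≡ V≡ = trans (isNode-and (entryᶠ F U V) (entryᶠ F V U) y)
    (cong₂ _∧_ (cong isNode (trans (cong₂ (λ a b → entry a b (eval V y)) F≡ U≡) (cong (entry C (vertex u)) V≡)))
               (cong isNode (trans (cong₂ (λ a b → entry a b (eval U y)) F≡ V≡) (cong (entry C (vertex v)) U≡))))

  middle? : ∀ u v w → Dec (u ~ w × w ~ v × c u w ≢ c w v)
  middle? u v w = (u ~? w) ×-dec (w ~? v) ×-dec ¬? (c u w Bool.≟ c w v)

  xor-≢ : ∀ a b → a xor b ≡ does (¬? (a Bool.≟ b))
  xor-≢ false false = refl
  xor-≢ false true  = refl
  xor-≢ true  false = refl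
  xor-≢ true  true  = refl

  isNode-middle : ∀ u m v m′ m″ w → isNode (eval middleᶠ (node (e₃ u m v m′) (node (vertex w) m″))) ≡ does (middle? u v w)
  isNode-middle u m v m′ m″ w = trans (isNode-and (entryᶠ Mᶠ uᶠ itemᶠ) (andᶠ (entryᶠ Mᶠ itemᶠ vᶠ) colours) y)
    (cong₂ _∧_ (isNode-edge u w) (trans (isNode-and (entryᶠ Mᶠ itemᶠ vᶠ) colours y)
      (cong₂ _∧_ (isNode-edge w v) (trans (isNode-xor (colourᶠ Cᶠ uᶠ itemᶠ) (colourᶠ Cᶠ itemᶠ vᶠ) y)
        (trans (cong₂ _xor_ (colour-eval {Cᶠ} {uᶠ} {itemᶠ} {y} u w refl refl refl)
                            (colour-eval {Cᶠ} {itemᶠ} {vᶠ} {y} w v refl refl refl))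
               (xor-≢ (c u w) (c w v)))))))
    where
    y = node (e₃ u m v m′) (node (vertex w) m″)
    Mᶠ = leftᶠ ⨾ᶠ leftᶠ ⨾ᶠ leftᶠ ⨾ᶠ leftᶠ ⨾ᶠ leftᶠ
    Cᶠ = leftᶠ ⨾ᶠ leftᶠ ⨾ᶠ leftᶠ ⨾ᶠ itemᶠ
    uᶠ = leftᶠ ⨾ᶠ leftᶠ ⨾ᶠ itemᶠ
    vᶠ = leftᶠ ⨾ᶠ itemᶠ
    colours = xorᶠ (colourᶠ Cᶠ uᶠ itemᶠ) (colourᶠ Cᶠ itemᶠ vᶠ)

  isNode-linked : ∀ u m v m′ → isNode (eval linkedᶠ (e₃ u m v m′)) ≡ does (linked? G c u v)
  isNode-linked u m v m′ = trans (isNode-and (notᶠ edge) middles y)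
    (cong₂ _∧_ (trans (isNode-not edge y) (cong not (isNode-edge u v)))
      (trans (cong isNode count) (reflects-does (λ (w , _ , p) → w , p) (λ (w , p) → w , ∈-descending w , p)
        (nonempty-filter (middle? u v) (descending order)) (Fin.any? (middle? u v)))))
    where
    y = e₃ u m v m′
    edge = entryᶠ (leftᶠ ⨾ᶠ leftᶠ ⨾ᶠ leftᶠ ⨾ᶠ leftᶠ) (leftᶠ ⨾ᶠ itemᶠ) itemᶠ
    middles = forᶠ (leftᶠ ⨾ᶠ leftᶠ ⨾ᶠ leftᶠ ⨾ᶠ verticesᶠ) nilᶠ (ifᶠ middleᶠ (sucᶠ accᶠ) accᶠ)
    step : Tree → Tree → Tree
    step m a = eval (ifᶠ middleᶠ (sucᶠ accᶠ) accᶠ) (node y (node a m))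
    count : eval middles y ≡ num (length (filter (middle? u v) (descending order)))
    count = trans (cong (λ l → foldl step leaf (elems l)) (eval-vertices G t))
      (trans (foldl-vertices {n = order} step leaf)
             (tally (middle? u v) {middleᶠ} {y} {vertex} (isNode-middle u m v m′) 0 (descending order)))

  -- Dropping i entries from a list with j entries leaves something exactly when i is below j.
  isNode-less : ∀ i j → isNode (foldl (λ m _ → rightᵗ m) (full j) (elems (full i))) ≡ (i <ᵇ j)
  isNode-less i j = trans (go (elems (full i)) j) (cong (_<ᵇ j) (length-elems-full i))
    where
    stuck : ∀ (as : List Tree) → foldl (λ m _ → rightᵗ m) leaf as ≡ leaf
    stuck []       = refl
    stuck (_ ∷ as) = stuck as
    go : ∀ (as : List Tree) j → isNode (foldl (λ m _ → rightᵗ m) (full j) as) ≡ (length as <ᵇ j)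
    go []       zero    = refl
    go []       (suc j) = refl
    go (a ∷ as) zero    = cong isNode (stuck as)
    go (a ∷ as) (suc j) = go as j

  isNode-satisfied : ∀ u m v m′ → isNode (eval satisfiedᶠ (e₃ u m v m′)) ≡ does (satisfied? G c (u , v))
  isNode-satisfied u m v m′ =
    trans (isNode-and (forᶠ (leftᶠ ⨾ᶠ itemᶠ) itemᶠ (accᶠ ⨾ᶠ rightᶠ)) linkedᶠ (e₃ u m v m′))
          (cong₂ _∧_ (isNode-less (Fin.toℕ u) (Fin.toℕ v)) (isNode-linked u m v m′))

  eval-count : eval countᶠ e₁ ≡ num (length (satisfied G c))
  eval-count = begin
    foldl (λ m a → outer m a (eval verticesᶠ x)) leaf (elems (eval verticesᶠ x))
      ≡⟨ cong (λ l → foldl (λ m a → outer m a l) leaf (elems l)) (eval-vertices G t) ⟩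
    foldl (λ m a → outer m a (full order)) leaf (elems (full order))
      ≡⟨ foldl-vertices {n = order} (λ m a → outer m a (full order)) leaf ⟩
    foldl (λ m u → outer m (vertex u) (full order)) leaf vs
      ≡⟨ foldl-count-product (satisfied? G c) row 0 vs ⟩
    num (length (filter (satisfied? G c) (cartesianProduct vs vs)))
      -- The program visits vertices in descending order and `pairs` lists them in ascending order;
      -- both orders count the same pairs.
      ≡⟨ cong num (≤-antisym
           (filter-mono (satisfied? G c) (satisfied? G c) (Unique.cartesianProduct⁺ vs-unique vs-unique)
             (λ {p} _ s → ∈-pairs p , s))
           (filter-mono (satisfied? G c) (satisfied? G c) (pairs-unique order)
             (λ { {u , v} _ s → ∈-cartesianProduct⁺ (∈-descending u) (∈-descending v) , s }))) ⟩
    num (length (satisfied G c)) ∎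
    where
    open ≡-Reasoning
    vs = descending order
    vs-unique = descending-unique order
    inner : Tree → Tree → Tree → Tree → Tree
    inner m a m′ b = eval (ifᶠ satisfiedᶠ (sucᶠ accᶠ) accᶠ) (node (node e₁ (node a m)) (node b m′))
    outer : Tree → Tree → Tree → Tree
    outer m a l = foldl (inner m a) m (elems l)
    row : ∀ m u → outer (num m) (vertex u) (full order)
                ≡ num (m + length (filter (λ v → satisfied? G c (u , v)) vs))
    row m u = trans (foldl-vertices {n = order} (inner (num m) (vertex u)) (num m))
      (tally (λ v → satisfied? G c (u , v)) {satisfiedᶠ} {e₂ u (num m)} {vertex}
             (λ m′ v → isNode-satisfied u (num m) v m′) m vs)

module _ (X : RainbowInstance) where
  open RainbowInstance X

  private
    x = encode X

  good? : U.Decidable (λ C → k < suc (length (satisfied graph (treeColour C))))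
  good? C = k <? suc (length (satisfied graph (treeColour C)))

  isNode-test : ∀ m C → isNode (eval testᶠ (node x (node C m))) ≡ does (good? C)
  isNode-test m C = trans
    (cong (λ l → isNode (eval ltᶠ (node (encodeℕ k) (node leaf l)))) (eval-count graph (encodeℕ k) C m))
    (eval-lt-ℕ k (suc (length (satisfied graph (treeColour C)))))

  candidates : List Tree
  candidates = elems (trees (suc (2 * order)))

  eval-search : eval searchᶠ x ≡ num (length (filter good? candidates))
  eval-search = trans (cong (λ l → foldl step leaf (elems l)) (eval-colours graph (encodeℕ k)))
                      (tally good? {testᶠ} {x} {id} isNode-test 0 candidates)
    where
    step : Tree → Tree → Tree
    step m C = eval (ifᶠ testᶠ (sucᶠ accᶠ) accᶠ) (node x (node C m))

  fromTree : Σ[ C ∈ Tree ] C ∈ candidates × k < suc (length (satisfied graph (treeColour C))) →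
             Solution graph k
  fromTree (C , _ , s≤s k≤) = record
    { c = treeColour C ; c-sym = λ u v → Bool.∧-comm (isNode (entry C (vertex u) (vertex v))) _ ; many = k≤ }

  -- The matrix of a solution obeys the depth bound of the candidates and, being symmetric, decodes
  -- to the same colouring.
  toTree : Solution graph k →
           Σ[ C ∈ Tree ] C ∈ candidates × k < suc (length (satisfied graph (treeColour C)))
  toTree sol = C , ∈-trees C (depth-matrix c) , s≤s (≤-trans many
    (filter-mono (satisfied? graph c) (satisfied? graph (treeColour C)) (pairs-unique order)
      λ p∈ (lt , u≁v , w , e , e′ , ne) → p∈ , lt , u≁v , w , e , e′ ,
        λ eq → ne (trans (sym (same _ _)) (trans eq (same _ _)))))
    where
    open Solution sol
    C = encodeMatrix c
    isNode-entry : ∀ u v → isNode (entry C (vertex u) (vertex v)) ≡ c u v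
    isNode-entry u v = trans (cong isNode (entry-matrix c u v)) (isNode-encodeBool (c u v))
    same : ∀ u v → treeColour C u v ≡ c u v
    same u v = trans (cong₂ _∧_ (isNode-entry u v) (trans (isNode-entry v u) (c-sym v u)))
                     (Bool.∧-idem (c u v))

  eval-brute : eval bruteᶠ x ≡ encodeBool (isNode (eval searchᶠ x))
  eval-brute with isNode (eval searchᶠ x)
  ... | true  = refl
  ... | false = refl

  brute-correct : Yes X ⇔ T (isNode (eval searchᶠ x))
  brute-correct = mk⇔
    (λ (c , p) → subst T (sym (cong isNode eval-search)) (complete (toTree (toSolution graph c p)) search))
    (λ t → fromSolution graph (fromTree (sound (subst T (cong isNode eval-search) t) search)))
    where
    search = nonempty-filter good? candidates
    complete : ∀ {P : Set} {b} → P → Reflects P b → T b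
    complete p (ofʸ _)  = _
    complete p (ofⁿ ¬p) = contradiction p ¬p
    sound : ∀ {P : Set} {b} → T b → Reflects P b → P
    sound _ (ofʸ p) = p

-- From a kernel to fixed parameter tractability

∈⇒≤sum : (f : A → ℕ) → ∀ {x xs} → x ∈ xs → f x ≤ sum (map f xs)
∈⇒≤sum f {xs = x ∷ xs} (here refl) = m≤m+n (f x) _
∈⇒≤sum f {xs = y ∷ xs} (there x∈)  = m≤n⇒m≤o+n (f y) (∈⇒≤sum f x∈)

-- The number of digits is bounded crudely by `k`; any bound in terms of the parameter serves.
depth-encodeℕ : ∀ k → depth (encodeℕ k) ≤ suc k
depth-encodeℕ k = ≤-trans (go (fromℕ k)) (≤-reflexive (cong suc (toℕ-fromℕ k)))
  where
  go : ∀ b → depth (encodeℕᵇ b) ≤ suc (toℕ b)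
  go 0ᵇ       = z≤n
  go 2[1+ b ] = s≤s (≤-trans (go b) (m≤m+n _ _))
  go 1+[2 b ] = s≤s (⊔-lub (s≤s z≤n) (≤-trans (go b) (s≤s (m≤m+n (toℕ b) _))))

depth-instance : ∀ (y : Instance) {n k} → RainbowInstance.order y ≤ n → parameter y ≤ k →
                 depth (encode y) ≤ suc (suc (2 * n) + suc k)
depth-instance y {n} {k} order≤ k≤ = s≤s (≤-trans
  (m⊔n≤m+n (depth (encodeGraph graph)) (depth (encodeℕ (parameter y))))
  (+-mono-≤ (≤-trans (depth-matrix (λ u v → does (u ~? v))) (s≤s (*-monoʳ-≤ 2 order≤)))
            (≤-trans (depth-encodeℕ (parameter y)) (s≤s k≤))))
  where open RainbowInstance y using (graph; _~?_)

-- The exhaustive search on a kernel takes time bounded by its total running time on all trees of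
-- the depth of such a kernel.
kernel⇒fpt : ∀ {bound} → HasKernel RainbowInstance.order bound → FixedParameterTractable
kernel⇒fpt {bound} (p , c , d , g , kernelise) = p ⨾ compile bruteᶠ , (λ k → c + total k) , d , λ x →
  let y , s , r , s≤ , iff , order≤ , k≤ = kernelise x
      t , q = run bruteᶠ (encode y)
      X = size (encode x)
      t≤ : t ≤ total (parameter x)
      t≤ = ∈⇒≤sum (time bruteᶠ) (∈-trees (encode y) (depth-instance y order≤ k≤))
      open ≤-Reasoning
  in isNode (eval searchᶠ (encode y)) , s + t ,
     ⇓-seq r (subst (λ z → compile bruteᶠ ∙ encode y ⇓ z ⟨ t ⟩) (eval-brute y) q) ,
     mk⇔ (Equivalence.to (brute-correct y) ∘ Equivalence.to iff)
         (Equivalence.from iff ∘ Equivalence.from (brute-correct y)) ,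
     (begin
       s + t                                    ≤⟨ +-mono-≤ s≤ t≤ ⟩
       c * X ^ d + total (parameter x)          ≤⟨ +-monoʳ-≤ (c * X ^ d) (m≤m*n (total (parameter x)) (X ^ d)
                                                     {{>-nonZero (m^n>0 X {{>-nonZero (1≤size (encode x))}} d)}}) ⟩
       c * X ^ d + total (parameter x) * X ^ d  ≡⟨ *-distribʳ-+ (X ^ d) c (total (parameter x)) ⟨
       (c + total (parameter x)) * X ^ d        ∎)
  where
  total : ℕ → ℕ
  total k = sum (map (time bruteᶠ) (elems (trees (suc (suc (2 * bound k) + suc (g k))))))

theorem8 : ParameterizedProblem.HasKernel MaxRainbow2Colouring RainbowInstance.order (λ k → 4 * k) × ParameterizedProblem.FixedParameterTractable MaxRainbow2Colouring
theorem8 = kernel , kernel⇒fpt kernel
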